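{- Let $n,B,k\in\mathbb{N}$ with $k\ge 2$ and $B\le n/k$, and let $f_j=1/j$ for $j\in[n]$. Let $h_1,\dots,h_k:[n]\to[B]$ be independent, truly (uniformly) random hash functions. For $i\in[n]$ define the random variable $$\tilde f_i=\min_{\ell\in[k]}\Big(\sum_{j\in[n]}[h_\ell(j)=h_\ell(i)]\,f_j\Big).$$ Then for every $i\in[n]$, $$\mathbb{E}\big[|\tilde f_i-f_i|\big]=\Theta\!\left(\frac{\log(n/B)}{B}\right),$$ where the implied constants are absolute (independent of $n,B,k,i$).
   Context: $[n]=\{1,\dots,n\}$. For an event $E$, $[E]\in\{0,1\}$ denotes its indicator. This $\tilde f_i$ is the Count-Min estimate of the frequency of item $i$ when the item frequencies follow the Zipfian law $f_j=1/j$. -}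

module Defs where

open import Data.Nat as ℕ using (ℕ; zero; suc)
open import Data.Fin using (Fin; zero; suc; toℕ; _≟_)
open import Data.List using (List; []; _∷_; [_]; map; concatMap; foldr; length)
open import Data.List using () renaming (allFin to allFinL)
open import Data.Integer using (+_)
open import Data.Rational using (ℚ; _+_; _-_; _*_; _/_; _⊓_; ∣_∣; 0ℚ)
open import Relation.Nullary using (yes; no)

sumℚ : List ℚ → ℚ
sumℚ = foldr _+_ 0ℚ

-- Uniform average of a finite (multi)set of outcomes; [] gives 0 (never used:
-- the sample spaces below are nonempty).
mean : List ℚ → ℚ
mean [] = 0ℚ
mean (x ∷ xs) = sumℚ (x ∷ xs) * ((+ 1) / suc (length xs))

allFunsOf : {A : Set} → (m : ℕ) → List A → List (Fin m → A)
allFunsOf zero xs = [ (λ ()) ]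
allFunsOf (suc m) xs =
  concatMap (λ a → map (λ h → λ { zero → a ; (suc j) → h j }) (allFunsOf m xs)) xs

allHashes : (n B : ℕ) → List (Fin n → Fin B)
allHashes n B = allFunsOf n (allFinL B)

allHashTuples : (k n B : ℕ) → List (Fin k → Fin n → Fin B)
allHashTuples k n B = allFunsOf k (allHashes n B)

-- Zipfian frequency f_j = 1/j for j ∈ [n]; item (j : Fin n) is j+1.
zipf : {n : ℕ} → Fin n → ℚ
zipf j = (+ 1) / suc (toℕ j)

-- Minimum over ℓ ∈ [k] (value at k = 0 is junk; the theorem assumes k ≥ 2).
minOver : (k : ℕ) → (Fin k → ℚ) → ℚ
minOver zero g = 0ℚ
minOver (suc zero) g = g zero
minOver (suc (suc k)) g = g zero ⊓ minOver (suc k) (λ ℓ → g (suc ℓ))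

bucketMass : {n B : ℕ} → (Fin n → Fin B) → Fin n → ℚ
bucketMass {n} h i = sumℚ (map term (allFinL n))
  where
  term : Fin n → ℚ
  term j with h j ≟ h i
  ... | yes _ = zipf j
  ... | no  _ = 0ℚ

countMin : {k n B : ℕ} → (Fin k → Fin n → Fin B) → Fin n → ℚ
countMin {k} hs i = minOver k (λ ℓ → bucketMass (hs ℓ) i)

expectedError : (k n B : ℕ) → Fin n → ℚ
expectedError k n B i =
  mean (map (λ hs → ∣ countMin hs i - zipf i ∣) (allHashTuples k n B))

{-# OPTIONS --safe #-}

-- Each table overestimates f_i by the excess X(h) = Σ_{j ≠ i} [h(j) = h(i)] / j, so the error is the
-- minimum of k independent copies of X. Write N = n / B.
--
-- Upper bound. Two tables suffice. Split X = T + R at j = B. The mean of R is at most about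
-- log N / B. Since the square root is subadditive, T ≤ S² with S = Σ_{j ≤ B} [h(j) = h(i)] / √j, whence
-- min(T₁, T₂) ≤ S₁ S₂, and by independence E[S₁ S₂] = (E S)² = O(1 / B).
--
-- Lower bound. If A - Ψ ≤ X pointwise with Ψ ≥ 0, then E[min X] ≥ A - k E[Ψ]. For large N, the
-- number Y of collisions among the first 2^m B items satisfies Y ≥ 1 + s - 2^(s - Y), and for s = 2^(m-2)
-- the mean of 2^(s - Y) is at most 1 / k once 2^m exceeds about log N. A geometric combination of these Y is
-- dominated by X, and each of the about (log N) / 2 admissible m contributes a constant multiple of 1 / B.
-- For bounded N, P(Y = 0) ≤ 1 / (k + 1) for the number Y of all collisions, and X ≥ Y / n.
module Submission where

open import Defs
open import Data.Nat as ℕ using (ℕ; NonZero; _≤_; zero; suc; z≤n; s≤s)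
open import Data.Nat.DivMod using (_/_; m≡m%n+[m/n]*n; m%n≤n; m/n*n≤m; m*n/n≡m; /-monoˡ-≤)
open import Data.Nat.Logarithm
  using (⌊log₂_⌋; ⌊log₂⌋-mono-≤; ⌊log₂⌊n/2⌋⌋≡⌊log₂n⌋∸1; ⌊log₂[2^n]⌋≡n)
open import Data.Fin using (Fin; zero; suc; toℕ; _≟_)
open import Data.Fin.Properties using (toℕ<n)
open import Data.Integer using (+_)
open import Data.Rational as ℚ using (ℚ; _*_; _<_; 0ℚ; 1ℚ; ½; _+_; _-_; _⊓_; ∣_∣)
  renaming (_≤_ to _≤ℚ_)
open import Data.Product using (Σ; _×_; _,_; proj₁; proj₂)

import Data.Integer as ℤ
import Data.Integer.Properties as ℤP
import Data.Nat.Properties as ℕP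
import Data.Rational.Properties as ℚP
import Data.Rational.Unnormalised as ℚᵘ
import Data.Rational.Unnormalised.Properties as ℚᵘP
open import Data.Bool using (true; false; if_then_else_)
open import Data.List using (List; []; _∷_; _++_; map; concatMap; length; tabulate)
  renaming (allFin to allFinL)
open import Data.List.Properties using (map-∘; length-map; length-++; length-tabulate)
open import Data.Maybe using (Maybe; just; nothing)
open import Data.Sum using (_⊎_; inj₁; inj₂)
open import Function using (_∘_; id)
open import Relation.Nullary using (Dec; does; yes; no; contradiction)
open import Relation.Binary.PropositionalEquality
  using (_≡_; refl; sym; trans; cong; cong₂; subst; subst₂; module ≡-Reasoning)
open import Tactic.RingSolver using (solve-∀)
open import Tactic.RingSolver.Core.AlmostCommutativeRing
  using (AlmostCommutativeRing; fromCommutativeRing)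
open import Data.Nat.Tactic.RingSolver using () renaming (solve-∀ to ℕ-solve-∀)

-- The mean of X alone is too large for the upper bound: the items j ≤ B contribute about log B / B
-- to it, which exceeds log(n / B) / B when B is close to n. Only for those items is the second
-- table used; the items beyond B are handled by linearity. For the lower bound the obstacle is that
-- k may be as large as n / B, so that a union bound requires each table to fail with probability at
-- most about 1 / k. Among the first 2^m B items about 2^m collisions are expected, and having far
-- fewer has probability exponentially small in 2^m. The scales with 2^m below about log k are
-- therefore given up. Starting at m near (1/2) log₂ N is generous, but it still keeps a constant
-- fraction of all scales. Everything takes place in ℚ. Exponential moments are products of factors
-- 1 - w/2, decay comes from forms of Bernoulli's inequality, and the square root is replaced by a
-- recursively defined sequence. The term O(1 / B) of the upper bound is absorbed because n / B ≥ k
-- ≥ 2 makes the logarithm at least 1.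

ℚ-ring : AlmostCommutativeRing _ _
ℚ-ring = fromCommutativeRing ℚP.+-*-commutativeRing isZero
  where
  isZero : ∀ x → Maybe (0ℚ ≡ x)
  isZero x with 0ℚ ℚP.≟ x
  ... | yes p = just p
  ... | no  _ = nothing

-- Ordered arithmetic in ℚ and reciprocals of naturals

≤-by-gap : ∀ {a b} d → 0ℚ ≤ℚ d → b ≡ a + d → a ≤ℚ b
≤-by-gap {a} d 0≤d b≡a+d = subst (a ≤ℚ_) (sym b≡a+d)
  (subst (_≤ℚ a + d) (ℚP.+-identityʳ a) (ℚP.+-monoʳ-≤ a 0≤d))

0≤b-a : ∀ {a b} → a ≤ℚ b → 0ℚ ≤ℚ b - a
0≤b-a {a} {b} a≤b = subst (_≤ℚ b - a) (ℚP.+-inverseʳ a) (ℚP.+-monoˡ-≤ (ℚ.- a) a≤b)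

*-mono-≤ˡ : ∀ {a b} c → 0ℚ ≤ℚ c → a ≤ℚ b → c * a ≤ℚ c * b
*-mono-≤ˡ c 0≤c = ℚP.*-monoˡ-≤-nonNeg c {{ℚ.nonNegative 0≤c}}

*-mono-≤ʳ : ∀ {a b} c → 0ℚ ≤ℚ c → a ≤ℚ b → a * c ≤ℚ b * c
*-mono-≤ʳ c 0≤c = ℚP.*-monoʳ-≤-nonNeg c {{ℚ.nonNegative 0≤c}}

*-nonneg : ∀ {a b} → 0ℚ ≤ℚ a → 0ℚ ≤ℚ b → 0ℚ ≤ℚ a * b
*-nonneg {a} {b} 0≤a 0≤b = subst (_≤ℚ a * b) (ℚP.*-zeroʳ a) (*-mono-≤ˡ a 0≤a 0≤b)

*-mono-≤ : ∀ {a b c d} → 0ℚ ≤ℚ a → 0ℚ ≤ℚ d → a ≤ℚ b → c ≤ℚ d → a * c ≤ℚ b * d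
*-mono-≤ {a} {b} {c} {d} 0≤a 0≤d a≤b c≤d =
  ℚP.≤-trans (*-mono-≤ˡ a 0≤a c≤d) (*-mono-≤ʳ d 0≤d a≤b)

+-nonneg : ∀ {a b} → 0ℚ ≤ℚ a → 0ℚ ≤ℚ b → 0ℚ ≤ℚ a + b
+-nonneg = ℚP.+-mono-≤

0≤1 : 0ℚ ≤ℚ 1ℚ
0≤1 = ℚP.nonNegative⁻¹ 1ℚ

0≤½ : 0ℚ ≤ℚ ½
0≤½ = ℚP.nonNegative⁻¹ ½

-- Recursive rather than `(+ n) ℚ./ 1`, so that inductions on n compute and small numerals such as
-- `ι 4` unfold to sums of `1ℚ` that the ring solver can treat.
ι : ℕ → ℚ
ι zero    = 0ℚ
ι (suc n) = 1ℚ + ι n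

0≤ι : ∀ n → 0ℚ ≤ℚ ι n
0≤ι zero    = ℚP.≤-refl
0≤ι (suc n) = +-nonneg 0≤1 (0≤ι n)

ι-+ : ∀ m n → ι (m ℕ.+ n) ≡ ι m + ι n
ι-+ zero    n = sym (ℚP.+-identityˡ (ι n))
ι-+ (suc m) n = trans (cong (λ z → 1ℚ + z) (ι-+ m n)) (sym (ℚP.+-assoc 1ℚ (ι m) (ι n)))

ι-* : ∀ m n → ι (m ℕ.* n) ≡ ι m * ι n
ι-* zero    n = sym (ℚP.*-zeroˡ (ι n))
ι-* (suc m) n = trans (ι-+ n (m ℕ.* n)) (trans (cong (λ z → ι n + z) (ι-* m n)) (lemma (ι n) (ι m)))
  where
  lemma : ∀ x y → x + y * x ≡ (1ℚ + y) * x
  lemma = solve-∀ ℚ-ring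

ι-mono : ∀ {m n} → m ≤ n → ι m ≤ℚ ι n
ι-mono {n = n} z≤n = 0≤ι n
ι-mono (s≤s m≤n) = ℚP.+-monoʳ-≤ 1ℚ (ι-mono m≤n)

inv : (n : ℕ) → .{{_ : NonZero n}} → ℚ
inv n = (+ 1) ℚ./ n

toℚᵘ-/ : ∀ m n → ℚ.toℚᵘ ((+ m) ℚ./ suc n) ℚᵘ.≃ ℚᵘ.mkℚᵘ (+ m) n
toℚᵘ-/ m n = ℚP.toℚᵘ-fromℚᵘ (ℚᵘ.mkℚᵘ (+ m) n)

/-suc : ∀ m n → (+ suc m) ℚ./ suc n ≡ inv (suc n) + (+ m) ℚ./ suc n
/-suc m n = ℚP.toℚᵘ-injective (begin
  ℚ.toℚᵘ ((+ suc m) ℚ./ suc n)                      ≈⟨ toℚᵘ-/ (suc m) n ⟩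
  ℚᵘ.mkℚᵘ (+ suc m) n                               ≈⟨ ℚᵘ.*≡* eq ⟩
  ℚᵘ.mkℚᵘ (+ 1) n ℚᵘ.+ ℚᵘ.mkℚᵘ (+ m) n              ≈⟨ ℚᵘP.+-cong (toℚᵘ-/ 1 n) (toℚᵘ-/ m n) ⟨
  ℚ.toℚᵘ (inv (suc n)) ℚᵘ.+ ℚ.toℚᵘ ((+ m) ℚ./ suc n) ≈⟨ ℚP.toℚᵘ-homo-+ (inv (suc n)) ((+ m) ℚ./ suc n) ⟨
  ℚ.toℚᵘ (inv (suc n) + (+ m) ℚ./ suc n)            ∎)
  where
  open ℚᵘP.≃-Reasoning
  N = + suc n
  eq : + suc m ℤ.* (N ℤ.* N) ≡ (+ 1 ℤ.* N ℤ.+ + m ℤ.* N) ℤ.* N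
  eq = trans (sym (ℤP.*-assoc (+ suc m) N N)) (cong (ℤ._* N) (ℤP.*-distribʳ-+ N (+ 1) (+ m)))

/-as-product : ∀ m n .{{_ : NonZero n}} → (+ m) ℚ./ n ≡ ι m * inv n
/-as-product zero    n       = trans (ℚP.0/n≡0 n) (sym (ℚP.*-zeroˡ (inv n)))
/-as-product (suc m) (suc n) = begin
  (+ suc m) ℚ./ suc n               ≡⟨ /-suc m n ⟩
  inv (suc n) + (+ m) ℚ./ suc n     ≡⟨ cong (λ z → inv (suc n) + z) (/-as-product m (suc n)) ⟩
  inv (suc n) + ι m * inv (suc n)   ≡⟨ lemma (inv (suc n)) (ι m) ⟩
  ι (suc m) * inv (suc n)           ∎
  where
  open ≡-Reasoning
  lemma : ∀ x y → x + y * x ≡ (1ℚ + y) * x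
  lemma = solve-∀ ℚ-ring

ι*inv : ∀ n .{{_ : NonZero n}} → ι n * inv n ≡ 1ℚ
ι*inv (suc n) = trans (sym (/-as-product (suc n) (suc n)))
  (ℚP.toℚᵘ-injective (ℚᵘP.≃-trans (toℚᵘ-/ (suc n) n)
    (ℚᵘ.*≡* (trans (ℤP.*-identityʳ (+ suc n)) (sym (ℤP.*-identityˡ (+ suc n)))))))

0≤inv : ∀ n .{{_ : NonZero n}} → 0ℚ ≤ℚ inv n
0≤inv (suc n) = ℚP.nonNegative⁻¹ (inv (suc n)) {{ℚP.normalize-nonNeg 1 (suc n)}}

≤-by-cross : ∀ {a b} n .{{_ : NonZero n}} → ι n * a ≤ℚ b → a ≤ℚ inv n * b
≤-by-cross {a} {b} n na≤b = subst (_≤ℚ inv n * b) eq (*-mono-≤ˡ (inv n) (0≤inv n) na≤b)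
  where
  lemma : ∀ x y z → x * (y * z) ≡ (y * x) * z
  lemma = solve-∀ ℚ-ring
  eq : inv n * (ι n * a) ≡ a
  eq = trans (lemma (inv n) (ι n) a) (trans (cong (_* a) (ι*inv n)) (ℚP.*-identityˡ a))

inv-anti : ∀ m n .{{_ : NonZero m}} .{{_ : NonZero n}} → m ≤ n → inv n ≤ℚ inv m
inv-anti m n m≤n = subst (inv n ≤ℚ_) (ℚP.*-identityʳ (inv m)) (≤-by-cross m
  (subst (ι m * inv n ≤ℚ_) (ι*inv n) (*-mono-≤ʳ (inv n) (0≤inv n) (ι-mono m≤n))))

inv-* : ∀ m n .{{_ : NonZero m}} .{{_ : NonZero n}} .{{_ : NonZero (m ℕ.* n)}} →
        inv (m ℕ.* n) ≡ inv m * inv n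
inv-* m n = begin
  z                             ≡⟨ lemma z (inv m) (inv n) ⟩
  z * 1ℚ * 1ℚ                   ≡⟨ cong₂ (λ a b → z * a * b) (ι*inv m) (ι*inv n) ⟨
  z * (ι m * inv m) * (ι n * inv n) ≡⟨ lemma₂ z (ι m) (inv m) (ι n) (inv n) ⟩
  (ι m * ι n * z) * (inv m * inv n) ≡⟨ cong (λ a → a * z * (inv m * inv n)) (ι-* m n) ⟨
  (ι (m ℕ.* n) * z) * (inv m * inv n) ≡⟨ cong (_* (inv m * inv n)) (ι*inv (m ℕ.* n)) ⟩
  1ℚ * (inv m * inv n)          ≡⟨ ℚP.*-identityˡ _ ⟩
  inv m * inv n                 ∎
  where
  open ≡-Reasoning
  z = inv (m ℕ.* n)
  lemma : ∀ z x y → z ≡ z * 1ℚ * 1ℚ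
  lemma = solve-∀ ℚ-ring
  lemma₂ : ∀ z a x b y → z * (a * x) * (b * y) ≡ (a * b * z) * (x * y)
  lemma₂ = solve-∀ ℚ-ring

-- Finite sums and products

∑ : (n : ℕ) → (Fin n → ℚ) → ℚ
∑ zero    f = 0ℚ
∑ (suc n) f = f zero + ∑ n (f ∘ suc)

∏ : (n : ℕ) → (Fin n → ℚ) → ℚ
∏ zero    f = 1ℚ
∏ (suc n) f = f zero * ∏ n (f ∘ suc)

∑-cong : ∀ n {f g : Fin n → ℚ} → (∀ j → f j ≡ g j) → ∑ n f ≡ ∑ n g
∑-cong zero    f≡g = refl
∑-cong (suc n) f≡g = cong₂ _+_ (f≡g zero) (∑-cong n (f≡g ∘ suc))

∏-cong : ∀ n {f g : Fin n → ℚ} → (∀ j → f j ≡ g j) → ∏ n f ≡ ∏ n g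
∏-cong zero    f≡g = refl
∏-cong (suc n) f≡g = cong₂ _*_ (f≡g zero) (∏-cong n (f≡g ∘ suc))

∑-mono : ∀ n {f g : Fin n → ℚ} → (∀ j → f j ≤ℚ g j) → ∑ n f ≤ℚ ∑ n g
∑-mono zero    f≤g = ℚP.≤-refl
∑-mono (suc n) f≤g = ℚP.+-mono-≤ (f≤g zero) (∑-mono n (f≤g ∘ suc))

∑-nonneg : ∀ n {f : Fin n → ℚ} → (∀ j → 0ℚ ≤ℚ f j) → 0ℚ ≤ℚ ∑ n f
∑-nonneg zero    0≤f = ℚP.≤-refl
∑-nonneg (suc n) 0≤f = +-nonneg (0≤f zero) (∑-nonneg n (0≤f ∘ suc))

∏-nonneg : ∀ n {f : Fin n → ℚ} → (∀ j → 0ℚ ≤ℚ f j) → 0ℚ ≤ℚ ∏ n f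
∏-nonneg zero    0≤f = 0≤1
∏-nonneg (suc n) 0≤f = *-nonneg (0≤f zero) (∏-nonneg n (0≤f ∘ suc))

∑-+ : ∀ n (f g : Fin n → ℚ) → ∑ n (λ j → f j + g j) ≡ ∑ n f + ∑ n g
∑-+ zero    f g = refl
∑-+ (suc n) f g = trans (cong (λ z → f zero + g zero + z) (∑-+ n (f ∘ suc) (g ∘ suc)))
  (lemma (f zero) (g zero) _ _)
  where
  lemma : ∀ a b c d → a + b + (c + d) ≡ a + c + (b + d)
  lemma = solve-∀ ℚ-ring

∑-*ˡ : ∀ n c (f : Fin n → ℚ) → ∑ n (λ j → c * f j) ≡ c * ∑ n f
∑-*ˡ zero    c f = sym (ℚP.*-zeroʳ c)
∑-*ˡ (suc n) c f = trans (cong (λ z → c * f zero + z) (∑-*ˡ n c (f ∘ suc)))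
  (sym (ℚP.*-distribˡ-+ c (f zero) _))

∑-swap : ∀ m n (f : Fin m → Fin n → ℚ) → ∑ m (λ i → ∑ n (f i)) ≡ ∑ n (λ j → ∑ m (λ i → f i j))
∑-swap zero    n f = sym (zeros n)
  where
  zeros : ∀ n → ∑ n (λ _ → 0ℚ) ≡ 0ℚ
  zeros zero    = refl
  zeros (suc n) = trans (ℚP.+-identityˡ _) (zeros n)
∑-swap (suc m) n f = trans (cong (λ z → ∑ n (f zero) + z) (∑-swap m n (f ∘ suc)))
  (sym (∑-+ n (f zero) (λ j → ∑ m (λ i → f (suc i) j))))

-- Expectations over finite sample spaces

E : {A : Set} → List A → (A → ℚ) → ℚ
E xs g = mean (map g xs)

total : {A : Set} → List A → (A → ℚ) → ℚ
total xs g = sumℚ (map g xs)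

-- The value at 0 agrees with `mean []`, so that linearity, monotonicity and Fubini hold for every
-- list, and nonemptiness enters only through `IsProb`.
weight : ℕ → ℚ
weight zero    = 0ℚ
weight (suc n) = inv (suc n)

weight-* : ∀ m n → weight (m ℕ.* n) ≡ weight m * weight n
weight-* zero    n       = sym (ℚP.*-zeroˡ (weight n))
weight-* (suc m) zero    = trans (cong weight (ℕP.*-zeroʳ m)) (sym (ℚP.*-zeroʳ (weight (suc m))))
weight-* (suc m) (suc n) = inv-* (suc m) (suc n)

0≤weight : ∀ n → 0ℚ ≤ℚ weight n
0≤weight zero    = ℚP.≤-refl
0≤weight (suc n) = 0≤inv (suc n)

mean-as-product : ∀ xs → mean xs ≡ sumℚ xs * weight (length xs)
mean-as-product []       = refl
mean-as-product (x ∷ xs) = refl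

module _ {A : Set} where

  E-as-product : ∀ (xs : List A) g → E xs g ≡ total xs g * weight (length xs)
  E-as-product xs g = trans (mean-as-product (map g xs))
    (cong (λ l → total xs g * weight l) (length-map g xs))

  total-cong : ∀ (xs : List A) {g h} → (∀ a → g a ≡ h a) → total xs g ≡ total xs h
  total-cong []       g≡h = refl
  total-cong (x ∷ xs) g≡h = cong₂ _+_ (g≡h x) (total-cong xs g≡h)

  total-mono : ∀ (xs : List A) {g h} → (∀ a → g a ≤ℚ h a) → total xs g ≤ℚ total xs h
  total-mono []       g≤h = ℚP.≤-refl
  total-mono (x ∷ xs) g≤h = ℚP.+-mono-≤ (g≤h x) (total-mono xs g≤h)

  total-+ : ∀ (xs : List A) g h → total xs (λ a → g a + h a) ≡ total xs g + total xs h
  total-+ []       g h = refl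
  total-+ (x ∷ xs) g h = trans (cong (λ z → g x + h x + z) (total-+ xs g h)) (lemma (g x) (h x) _ _)
    where
    lemma : ∀ a b c d → a + b + (c + d) ≡ a + c + (b + d)
    lemma = solve-∀ ℚ-ring

  total-*ˡ : ∀ (xs : List A) c g → total xs (λ a → c * g a) ≡ c * total xs g
  total-*ˡ []       c g = sym (ℚP.*-zeroʳ c)
  total-*ˡ (x ∷ xs) c g = trans (cong (λ z → c * g x + z) (total-*ˡ xs c g)) (sym (ℚP.*-distribˡ-+ c (g x) _))

  total-0 : ∀ (xs : List A) → total xs (λ _ → 0ℚ) ≡ 0ℚ
  total-0 []       = refl
  total-0 (x ∷ xs) = trans (ℚP.+-identityˡ _) (total-0 xs)

  total-++ : ∀ (xs ys : List A) g → total (xs ++ ys) g ≡ total xs g + total ys g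
  total-++ []       ys g = sym (ℚP.+-identityˡ _)
  total-++ (x ∷ xs) ys g = trans (cong (λ z → g x + z) (total-++ xs ys g)) (sym (ℚP.+-assoc (g x) _ _))

  E-cong : ∀ (xs : List A) {g h} → (∀ a → g a ≡ h a) → E xs g ≡ E xs h
  E-cong xs {g} {h} g≡h = trans (E-as-product xs g)
    (trans (cong (_* weight (length xs)) (total-cong xs g≡h)) (sym (E-as-product xs h)))

  E-mono : ∀ (xs : List A) {g h} → (∀ a → g a ≤ℚ h a) → E xs g ≤ℚ E xs h
  E-mono xs {g} {h} g≤h rewrite E-as-product xs g | E-as-product xs h =
    *-mono-≤ʳ (weight (length xs)) (0≤weight (length xs)) (total-mono xs g≤h)

  E-+ : ∀ (xs : List A) g h → E xs (λ a → g a + h a) ≡ E xs g + E xs h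
  E-+ xs g h rewrite E-as-product xs g | E-as-product xs h | E-as-product xs (λ a → g a + h a) =
    trans (cong (_* weight (length xs)) (total-+ xs g h)) (ℚP.*-distribʳ-+ (weight (length xs)) (total xs g) (total xs h))

  E-*ˡ : ∀ (xs : List A) c g → E xs (λ a → c * g a) ≡ c * E xs g
  E-*ˡ xs c g rewrite E-as-product xs g | E-as-product xs (λ a → c * g a) =
    trans (cong (_* weight (length xs)) (total-*ˡ xs c g)) (ℚP.*-assoc c _ _)

  E-*ʳ : ∀ (xs : List A) g c → E xs (λ a → g a * c) ≡ E xs g * c
  E-*ʳ xs g c = trans (E-cong xs (λ a → ℚP.*-comm (g a) c)) (trans (E-*ˡ xs c g) (ℚP.*-comm c _))

  E-∑ : ∀ (xs : List A) n (g : A → Fin n → ℚ) →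
        E xs (λ a → ∑ n (g a)) ≡ ∑ n (λ j → E xs (λ a → g a j))
  E-∑ xs zero    g = trans (E-as-product xs (λ _ → 0ℚ))
    (trans (cong (_* weight (length xs)) (total-0 xs)) (ℚP.*-zeroˡ (weight (length xs))))
  E-∑ xs (suc n) g = trans (E-+ xs (λ a → g a zero) (λ a → ∑ n (g a ∘ suc)))
    (cong (λ z → E xs (λ a → g a zero) + z) (E-∑ xs n (λ a → g a ∘ suc)))

  IsProb : List A → Set
  IsProb xs = E xs (λ _ → 1ℚ) ≡ 1ℚ

  E-const : ∀ (xs : List A) → IsProb xs → ∀ c → E xs (λ _ → c) ≡ c
  E-const xs prob c = begin
    E xs (λ _ → c)       ≡⟨ E-cong xs (λ _ → ℚP.*-identityʳ c) ⟨
    E xs (λ _ → c * 1ℚ)  ≡⟨ E-*ˡ xs c (λ _ → 1ℚ) ⟩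
    c * E xs (λ _ → 1ℚ)  ≡⟨ cong (c *_) prob ⟩
    c * 1ℚ               ≡⟨ ℚP.*-identityʳ c ⟩
    c                    ∎
    where open ≡-Reasoning

total-swap : {A B : Set} (xs : List A) (ys : List B) (g : A → B → ℚ) →
             total xs (λ a → total ys (g a)) ≡ total ys (λ b → total xs (λ a → g a b))
total-swap []       ys g = sym (total-0 ys)
total-swap (x ∷ xs) ys g = trans (cong (λ z → total ys (g x) + z) (total-swap xs ys g))
  (sym (total-+ ys (g x) (λ b → total xs (λ a → g a b))))

E-E : {A B : Set} (xs : List A) (ys : List B) (g : A → B → ℚ) →
      E xs (λ a → E ys (g a)) ≡ total xs (λ a → total ys (g a)) * (weight (length xs) * weight (length ys))
E-E xs ys g = begin
  E xs (λ a → E ys (g a))                       ≡⟨ E-cong xs (λ a → E-as-product ys (g a)) ⟩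
  E xs (λ a → total ys (g a) * weight (length ys)) ≡⟨ E-*ʳ xs (λ a → total ys (g a)) (weight (length ys)) ⟩
  E xs (λ a → total ys (g a)) * weight (length ys) ≡⟨ cong (_* weight (length ys)) (E-as-product xs _) ⟩
  total xs (λ a → total ys (g a)) * weight (length xs) * weight (length ys) ≡⟨ ℚP.*-assoc (total xs (λ a → total ys (g a))) (weight (length xs)) (weight (length ys)) ⟩
  total xs (λ a → total ys (g a)) * (weight (length xs) * weight (length ys)) ∎
  where open ≡-Reasoning

E-swap : {A B : Set} (xs : List A) (ys : List B) (g : A → B → ℚ) →
         E xs (λ a → E ys (g a)) ≡ E ys (λ b → E xs (λ a → g a b))
E-swap xs ys g = trans (E-E xs ys g) (trans
  (cong₂ _*_ (total-swap xs ys g) (ℚP.*-comm (weight (length xs)) (weight (length ys))))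
  (sym (E-E ys xs (λ b a → g a b))))

-- Fubini for a list of pairs: its length is the product of the lengths, so `weight-*` splits the
-- normalisation. The pairing `c` is arbitrary because the one in `allFunsOf` has no name.
E-product : {A B C : Set} (xs : List A) (ys : List B) (c : A → B → C) (g : C → ℚ) →
            E (concatMap (λ a → map (c a) ys) xs) g ≡ E xs (λ a → E ys (λ b → g (c a b)))
E-product {A} xs ys c g = begin
  E (pairs xs) g ≡⟨ E-as-product (pairs xs) g ⟩
  total (pairs xs) g * weight (length (pairs xs))
    ≡⟨ cong₂ _*_ (total-pairs xs) (trans (cong weight (length-pairs xs)) (weight-* (length xs) (length ys))) ⟩
  total xs (λ a → total ys (λ b → g (c a b))) * (weight (length xs) * weight (length ys))
    ≡⟨ E-E xs ys (λ a b → g (c a b)) ⟨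
  E xs (λ a → E ys (λ b → g (c a b))) ∎
  where
  open ≡-Reasoning
  pairs : List A → List _
  pairs = concatMap (λ a → map (c a) ys)
  total-pairs : ∀ xs → total (pairs xs) g ≡ total xs (λ a → total ys (λ b → g (c a b)))
  total-pairs []       = refl
  total-pairs (x ∷ xs) = trans (total-++ (map (c x) ys) (pairs xs) g)
    (cong₂ _+_ (cong sumℚ (sym (map-∘ ys))) (total-pairs xs))
  length-pairs : ∀ xs → length (pairs xs) ≡ length xs ℕ.* length ys
  length-pairs []       = refl
  length-pairs (x ∷ xs) = trans (length-++ (map (c x) ys))
    (cong₂ ℕ._+_ (length-map (c x) ys) (length-pairs xs))

-- Uniform random functions: marginals and independence

ind : {P : Set} → Dec P → ℚ
ind d = if does d then 1ℚ else 0ℚ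

-- Defs builds its functions with an anonymous pattern-matching λ; taking the constructor from a
-- metavariable solution is the only way to refer to it.
allFunsOf-suc : {A : Set} (m : ℕ) (xs : List A) →
  Σ (A → (Fin m → A) → Fin (suc m) → A) λ c →
    allFunsOf (suc m) xs ≡ concatMap (λ a → map (c a) (allFunsOf m xs)) xs
allFunsOf-suc m xs = _ , refl

cons : {A : Set} {m : ℕ} → List A → A → (Fin m → A) → Fin (suc m) → A
cons {m = m} xs = proj₁ (allFunsOf-suc m xs)

E-cons : {A : Set} (m : ℕ) (xs : List A) (g : (Fin (suc m) → A) → ℚ) →
  E (allFunsOf (suc m) xs) g ≡ E xs (λ a → E (allFunsOf m xs) (λ h → g (cons xs a h)))
E-cons m xs g = E-product xs (allFunsOf m xs) (cons xs) g

module _ {A : Set} {xs : List A} where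

  allFunsOf-IsProb : IsProb xs → ∀ m → IsProb (allFunsOf m xs)
  allFunsOf-IsProb prob zero    = refl
  allFunsOf-IsProb prob (suc m) = trans (E-cons m xs (λ _ → 1ℚ))
    (trans (E-cong xs (λ _ → allFunsOf-IsProb prob m)) prob)

  E-marginal : IsProb xs → ∀ {m} (j : Fin m) (g : A → ℚ) →
               E (allFunsOf m xs) (λ h → g (h j)) ≡ E xs g
  E-marginal prob {suc m} zero    g = trans (E-cons m xs (λ h → g (h zero)))
    (E-cong xs (λ a → E-const (allFunsOf m xs) (allFunsOf-IsProb prob m) (g a)))
  E-marginal prob {suc m} (suc j) g = trans (E-cons m xs (λ h → g (h (suc j))))
    (trans (E-cong xs (λ a → E-marginal prob j g)) (E-const xs prob (E xs g)))

  E-∏ : ∀ m (g : Fin m → A → ℚ) →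
        E (allFunsOf m xs) (λ h → ∏ m (λ j → g j (h j))) ≡ ∏ m (λ j → E xs (g j))
  E-∏ zero    g = refl
  E-∏ (suc m) g = begin
    E (allFunsOf (suc m) xs) (λ h → ∏ (suc m) (λ j → g j (h j)))
      ≡⟨ E-cons m xs _ ⟩
    E xs (λ a → E (allFunsOf m xs) (λ h → g zero a * ∏ m (λ j → g (suc j) (h j))))
      ≡⟨ E-cong xs (λ a → E-*ˡ (allFunsOf m xs) (g zero a) (λ h → ∏ m (λ j → g (suc j) (h j)))) ⟩
    E xs (λ a → g zero a * E (allFunsOf m xs) (λ h → ∏ m (λ j → g (suc j) (h j))))
      ≡⟨ E-*ʳ xs (g zero) (E (allFunsOf m xs) (λ h → ∏ m (λ j → g (suc j) (h j)))) ⟩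
    E xs (g zero) * E (allFunsOf m xs) (λ h → ∏ m (λ j → g (suc j) (h j)))
      ≡⟨ cong (E xs (g zero) *_) (E-∏ m (g ∘ suc)) ⟩
    ∏ (suc m) (λ j → E xs (g j)) ∎
    where open ≡-Reasoning

  E-independent : IsProb xs → ∀ m (f g : A → ℚ) →
    E (allFunsOf (suc (suc m)) xs) (λ h → f (h zero) * g (h (suc zero))) ≡ E xs f * E xs g
  E-independent prob m f g = begin
    E (allFunsOf (suc (suc m)) xs) (λ h → f (h zero) * g (h (suc zero)))
      ≡⟨ E-cons (suc m) xs _ ⟩
    E xs (λ a → E (allFunsOf (suc m) xs) (λ h → f a * g (h zero)))
      ≡⟨ E-cong xs (λ a → E-*ˡ (allFunsOf (suc m) xs) (f a) (λ h → g (h zero))) ⟩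
    E xs (λ a → f a * E (allFunsOf (suc m) xs) (λ h → g (h zero)))
      ≡⟨ E-*ʳ xs f (E (allFunsOf (suc m) xs) (λ h → g (h zero))) ⟩
    E xs f * E (allFunsOf (suc m) xs) (λ h → g (h zero))
      ≡⟨ cong (E xs f *_) (E-marginal prob {suc m} zero g) ⟩
    E xs f * E xs g ∎
    where open ≡-Reasoning

total-tabulate : {A : Set} (n : ℕ) (f : Fin n → A) (g : A → ℚ) →
                 total (tabulate f) g ≡ ∑ n (g ∘ f)
total-tabulate zero    f g = refl
total-tabulate (suc n) f g = cong (λ z → g (f zero) + z) (total-tabulate n (f ∘ suc) g)

weight-NonZero : ∀ n .{{_ : NonZero n}} → weight n ≡ inv n
weight-NonZero (suc n) = refl

E-allFin : ∀ n .{{_ : NonZero n}} g → E (allFinL n) g ≡ ∑ n g * inv n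
E-allFin n g = trans (E-as-product (allFinL n) g) (cong₂ _*_ (total-tabulate n id g)
  (trans (cong weight (length-tabulate {n = n} id)) (weight-NonZero n)))

∑-const : ∀ n c → ∑ n (λ _ → c) ≡ ι n * c
∑-const zero    c = sym (ℚP.*-zeroˡ c)
∑-const (suc n) c = trans (cong (λ z → c + z) (∑-const n c)) (lemma c (ι n))
  where
  lemma : ∀ c x → c + x * c ≡ (1ℚ + x) * c
  lemma = solve-∀ ℚ-ring

allFin-IsProb : ∀ n .{{_ : NonZero n}} → IsProb (allFinL n)
allFin-IsProb n = trans (E-allFin n (λ _ → 1ℚ)) (trans (cong (_* inv n)
  (trans (∑-const n 1ℚ) (ℚP.*-identityʳ (ι n)))) (ι*inv n))

-- Since `ind` reads only `does`, `ind (suc a ≟ suc b)` reduces to `ind (a ≟ b)` and the induction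
-- computes.
∑-ind : ∀ n (b : Fin n) → ∑ n (λ a → ind (a ≟ b)) ≡ 1ℚ
∑-ind (suc n) zero    = cong (λ z → 1ℚ + z) (trans (∑-const n 0ℚ) (ℚP.*-zeroʳ (ι n)))
∑-ind (suc n) (suc b) = trans (ℚP.+-identityˡ _) (∑-ind n b)

E-ind : ∀ n .{{_ : NonZero n}} (b : Fin n) → E (allFinL n) (λ a → ind (a ≟ b)) ≡ inv n
E-ind n b = trans (E-allFin n (λ a → ind (a ≟ b)))
  (trans (cong (_* inv n) (∑-ind n b)) (ℚP.*-identityˡ (inv n)))

-- Collision indicators and the excess of a bucket

-- The collision indicator [h j = h i], except that it is 0 for j = i.
coll : {n B : ℕ} → (Fin n → Fin B) → Fin n → Fin n → ℚ
coll h zero    zero    = 0ℚ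
coll h zero    (suc j) = ind (h (suc j) ≟ h zero)
coll h (suc i) zero    = ind (h zero ≟ h (suc i))
coll h (suc i) (suc j) = coll (h ∘ suc) i j

other : {n : ℕ} → Fin n → Fin n → ℚ
other zero    zero    = 0ℚ
other zero    (suc j) = 1ℚ
other (suc i) zero    = 1ℚ
other (suc i) (suc j) = other i j

module _ (B : ℕ) .{{_ : NonZero B}} where

  private
    buckets : List (Fin B)
    buckets = allFinL B

  allHashes-IsProb : ∀ n → IsProb (allHashes n B)
  allHashes-IsProb n = allFunsOf-IsProb (allFin-IsProb B) n

  -- An inequality only because of j = i, where the indicator is 0. Otherwise one of the two hash
  -- values is averaged while the other is held fixed.
  E-coll : ∀ {n} (i j : Fin n) → E (allHashes n B) (λ h → coll h i j) ≤ℚ inv B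
  E-coll {suc n} zero zero =
    subst (_≤ℚ inv B) (sym (E-const (allHashes (suc n) B) (allHashes-IsProb (suc n)) 0ℚ)) (0≤inv B)
  E-coll {suc n} zero (suc j) = ℚP.≤-reflexive (begin
    E (allHashes (suc n) B) (λ h → ind (h (suc j) ≟ h zero))
      ≡⟨ E-cons n buckets _ ⟩
    E buckets (λ a → E (allHashes n B) (λ h → ind (h j ≟ a)))
      ≡⟨ E-cong buckets (λ a → trans (E-marginal (allFin-IsProb B) j (λ b → ind (b ≟ a))) (E-ind B a)) ⟩
    E buckets (λ a → inv B)
      ≡⟨ E-const buckets (allFin-IsProb B) (inv B) ⟩
    inv B ∎)
    where open ≡-Reasoning
  E-coll {suc n} (suc i) zero = ℚP.≤-reflexive (begin
    E (allHashes (suc n) B) (λ h → ind (h zero ≟ h (suc i)))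
      ≡⟨ E-cons n buckets _ ⟩
    E buckets (λ a → E (allHashes n B) (λ h → ind (a ≟ h i)))
      -- The bucket of item `zero` has to be averaged with `h i` held fixed, so the order of
      -- averaging is exchanged.
      ≡⟨ E-swap buckets (allHashes n B) (λ a h → ind (a ≟ h i)) ⟩
    E (allHashes n B) (λ h → E buckets (λ a → ind (a ≟ h i)))
      ≡⟨ E-cong (allHashes n B) (λ h → E-ind B (h i)) ⟩
    E (allHashes n B) (λ h → inv B)
      ≡⟨ E-const (allHashes n B) (allHashes-IsProb n) (inv B) ⟩
    inv B ∎)
    where open ≡-Reasoning
  E-coll {suc n} (suc i) (suc j) = subst (_≤ℚ inv B) (sym (begin
    E (allHashes (suc n) B) (λ h → coll h (suc i) (suc j))
      ≡⟨ E-cons n buckets _ ⟩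
    E buckets (λ a → E (allHashes n B) (λ h → coll h i j))
      ≡⟨ E-const buckets (allFin-IsProb B) _ ⟩
    E (allHashes n B) (λ h → coll h i j) ∎)) (E-coll i j)
    where open ≡-Reasoning

  E-thinned : ∀ t (b : Fin B) → E buckets (λ a → 1ℚ - t * ind (a ≟ b)) ≡ 1ℚ - t * inv B
  E-thinned t b = begin
    E buckets (λ a → 1ℚ - t * ind (a ≟ b))
      ≡⟨ E-cong buckets (λ a → lemma t (ind (a ≟ b))) ⟩
    E buckets (λ a → 1ℚ + (ℚ.- t) * ind (a ≟ b))
      ≡⟨ E-+ buckets (λ _ → 1ℚ) (λ a → (ℚ.- t) * ind (a ≟ b)) ⟩
    E buckets (λ _ → 1ℚ) + E buckets (λ a → (ℚ.- t) * ind (a ≟ b))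
      ≡⟨ cong₂ _+_ (allFin-IsProb B) (trans (E-*ˡ buckets (ℚ.- t) (λ a → ind (a ≟ b))) (cong (ℚ.- t *_) (E-ind B b))) ⟩
    1ℚ + (ℚ.- t) * inv B
      ≡⟨ lemma t (inv B) ⟨
    1ℚ - t * inv B ∎
    where
    open ≡-Reasoning
    lemma : ∀ t x → 1ℚ - t * x ≡ 1ℚ + (ℚ.- t) * x
    lemma = solve-∀ ℚ-ring

  -- Given `h i`, the other items collide with `i` independently, with probability 1/B each. The
  -- average of a factor does not depend on the value of `h i`; this is why the factors of the items
  -- before `i` can be pulled out one at a time.
  E-∏-coll : ∀ {n} (i : Fin n) (θ : Fin n → ℚ) →
    E (allHashes n B) (λ h → ∏ n (λ j → 1ℚ - θ j * coll h i j)) ≡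
    ∏ n (λ j → 1ℚ - θ j * (other i j * inv B))
  E-∏-coll {suc n} zero θ = begin
    E (allHashes (suc n) B) (λ h → ∏ (suc n) (λ j → 1ℚ - θ j * coll h zero j))
      ≡⟨ E-cons n buckets _ ⟩
    E buckets (λ a → E (allHashes n B) (λ h → (1ℚ - θ zero * 0ℚ) * ∏ n (λ j → 1ℚ - θ (suc j) * ind (h j ≟ a))))
      ≡⟨ E-cong buckets (λ a → E-*ˡ (allHashes n B) (1ℚ - θ zero * 0ℚ) (λ h → ∏ n (λ j → 1ℚ - θ (suc j) * ind (h j ≟ a)))) ⟩
    E buckets (λ a → (1ℚ - θ zero * 0ℚ) * E (allHashes n B) (λ h → ∏ n (λ j → 1ℚ - θ (suc j) * ind (h j ≟ a))))
      ≡⟨ E-cong buckets (λ a → cong₂ _*_ (lemma₀ (θ zero) (inv B))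
           (trans (E-∏ n (λ j b → 1ℚ - θ (suc j) * ind (b ≟ a)))
             (∏-cong n (λ j → trans (E-thinned (θ (suc j)) a) (lemma₁ (θ (suc j)) (inv B)))))) ⟩
    E buckets (λ a → ∏ (suc n) (λ j → 1ℚ - θ j * (other zero j * inv B)))
      ≡⟨ E-const buckets (allFin-IsProb B) _ ⟩
    ∏ (suc n) (λ j → 1ℚ - θ j * (other zero j * inv B)) ∎
    where
    open ≡-Reasoning
    lemma₀ : ∀ t x → 1ℚ - t * 0ℚ ≡ 1ℚ - t * (0ℚ * x)
    lemma₀ = solve-∀ ℚ-ring
    lemma₁ : ∀ t x → 1ℚ - t * x ≡ 1ℚ - t * (1ℚ * x)
    lemma₁ = solve-∀ ℚ-ring
  E-∏-coll {suc n} (suc i) θ = begin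
    E (allHashes (suc n) B) (λ h → ∏ (suc n) (λ j → 1ℚ - θ j * coll h (suc i) j))
      ≡⟨ E-cons n buckets _ ⟩
    E buckets (λ a → E (allHashes n B) (λ h → (1ℚ - θ zero * ind (a ≟ h i)) * rest h))
      ≡⟨ E-swap buckets (allHashes n B) (λ a h → (1ℚ - θ zero * ind (a ≟ h i)) * rest h) ⟩
    E (allHashes n B) (λ h → E buckets (λ a → (1ℚ - θ zero * ind (a ≟ h i)) * rest h))
      ≡⟨ E-cong (allHashes n B) (λ h → trans (E-*ʳ buckets (λ a → 1ℚ - θ zero * ind (a ≟ h i)) (rest h))
           (cong (_* rest h) (trans (E-thinned (θ zero) (h i)) (lemma (θ zero) (inv B))))) ⟩
    E (allHashes n B) (λ h → (1ℚ - θ zero * (1ℚ * inv B)) * rest h)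
      ≡⟨ E-*ˡ (allHashes n B) (1ℚ - θ zero * (1ℚ * inv B)) rest ⟩
    (1ℚ - θ zero * (1ℚ * inv B)) * E (allHashes n B) rest
      ≡⟨ cong (λ z → (1ℚ - θ zero * (1ℚ * inv B)) * z) (E-∏-coll i (θ ∘ suc)) ⟩
    ∏ (suc n) (λ j → 1ℚ - θ j * (other (suc i) j * inv B)) ∎
    where
    open ≡-Reasoning
    rest : (Fin n → Fin B) → ℚ
    rest h = ∏ n (λ j → 1ℚ - θ (suc j) * coll h i j)
    lemma : ∀ t x → 1ℚ - t * x ≡ 1ℚ - t * (1ℚ * x)
    lemma = solve-∀ ℚ-ring

coll-01 : ∀ {n B} (h : Fin n → Fin B) i j (P : ℚ → Set) → P 0ℚ → P 1ℚ → P (coll h i j)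
coll-01 h zero    zero    P p₀ p₁ = p₀
coll-01 h zero    (suc j) P p₀ p₁ with does (h (suc j) ≟ h zero)
... | true  = p₁
... | false = p₀
coll-01 h (suc i) zero    P p₀ p₁ with does (h zero ≟ h (suc i))
... | true  = p₁
... | false = p₀
coll-01 h (suc i) (suc j) P p₀ p₁ = coll-01 (h ∘ suc) i j P p₀ p₁

0≤coll : ∀ {n B} (h : Fin n → Fin B) i j → 0ℚ ≤ℚ coll h i j
0≤coll h i j = coll-01 h i j (0ℚ ≤ℚ_) ℚP.≤-refl 0≤1

excess : {n B : ℕ} → (Fin n → Fin B) → Fin n → ℚ
excess {n} h i = ∑ n (λ j → zipf j * coll h i j)

0≤excess : ∀ {n B} (h : Fin n → Fin B) i → 0ℚ ≤ℚ excess h i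
0≤excess {n} h i = ∑-nonneg n (λ j → *-nonneg (0≤inv (suc (toℕ j))) (0≤coll h i j))

-- The summand is local to `bucketMass`, so it too is recovered as a metavariable solution.
bucketMass-terms : ∀ {n B} (h : Fin n → Fin B) i →
  Σ (Fin n → ℚ) λ t → bucketMass h i ≡ total (allFinL n) t
bucketMass-terms h i = _ , refl

bucketMass-term : ∀ {n B} (h : Fin n → Fin B) i j →
  proj₁ (bucketMass-terms h i) j ≡ zipf j * ind (h j ≟ h i)
bucketMass-term h i j with h j ≟ h i
... | yes _ = sym (ℚP.*-identityʳ (zipf j))
... | no  _ = sym (ℚP.*-zeroʳ (zipf j))

∑-ind-split : ∀ {n B} (h : Fin n → Fin B) i (f : Fin n → ℚ) →
  ∑ n (λ j → f j * ind (h j ≟ h i)) ≡ f i + ∑ n (λ j → f j * coll h i j)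
∑-ind-split {suc n} h zero f = trans (cong (λ z → f zero * z + tail) ind-refl)
  (lemma (f zero) tail)
  where
  tail : ℚ
  tail = ∑ n (λ j → f (suc j) * ind (h (suc j) ≟ h zero))
  ind-refl : ind (h zero ≟ h zero) ≡ 1ℚ
  ind-refl with h zero ≟ h zero
  ... | yes _ = refl
  ... | no ¬p = contradiction refl ¬p
  lemma : ∀ a b → a * 1ℚ + b ≡ a + (a * 0ℚ + b)
  lemma = solve-∀ ℚ-ring
∑-ind-split {suc n} h (suc i) f = trans
  (cong (λ z → f zero * ind (h zero ≟ h (suc i)) + z) (∑-ind-split (h ∘ suc) i (f ∘ suc)))
  (lemma (f zero * ind (h zero ≟ h (suc i))) (f (suc i)) _)
  where
  lemma : ∀ a b c → a + (b + c) ≡ b + (a + c)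
  lemma = solve-∀ ℚ-ring

bucketMass-excess : ∀ {n B} (h : Fin n → Fin B) i → bucketMass h i ≡ zipf i + excess h i
bucketMass-excess {n} h i = begin
  bucketMass h i                                  ≡⟨ proj₂ (bucketMass-terms h i) ⟩
  total (allFinL n) (proj₁ (bucketMass-terms h i)) ≡⟨ total-cong (allFinL n) (bucketMass-term h i) ⟩
  total (allFinL n) (λ j → zipf j * ind (h j ≟ h i)) ≡⟨ total-tabulate n id _ ⟩
  ∑ n (λ j → zipf j * ind (h j ≟ h i))            ≡⟨ ∑-ind-split h i zipf ⟩
  zipf i + excess h i                             ∎
  where open ≡-Reasoning

-- From the minimum over the tables to the excess of single tables

minOver-greatest : ∀ k g a → 1 ≤ k → (∀ ℓ → a ≤ℚ g ℓ) → a ≤ℚ minOver k g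
minOver-greatest (suc zero)    g a _ a≤g = a≤g zero
minOver-greatest (suc (suc k)) g a _ a≤g =
  ℚP.⊓-glb (a≤g zero) (minOver-greatest (suc k) (g ∘ suc) a (s≤s z≤n) (a≤g ∘ suc))

minOver-lower : ∀ k g ℓ → minOver k g ≤ℚ g ℓ
minOver-lower (suc zero)    g zero    = ℚP.≤-refl
minOver-lower (suc (suc k)) g zero    = ℚP.p⊓q≤p (g zero) _
minOver-lower (suc (suc k)) g (suc ℓ) = ℚP.≤-trans (ℚP.p⊓q≤q (g zero) _) (minOver-lower (suc k) (g ∘ suc) ℓ)

∣error∣ : ∀ {k n B} (hs : Fin k → Fin n → Fin B) i → 1 ≤ k →
          ∣ countMin hs i - zipf i ∣ ≡ countMin hs i - zipf i
∣error∣ {k} hs i 1≤k = ℚP.0≤p⇒∣p∣≡p (0≤b-a (minOver-greatest k _ (zipf i) 1≤k λ ℓ →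
  ≤-by-gap (excess (hs ℓ) i) (0≤excess (hs ℓ) i) (bucketMass-excess (hs ℓ) i)))

error-greatest : ∀ {k n B} (hs : Fin k → Fin n → Fin B) i a → 1 ≤ k →
  (∀ ℓ → a ≤ℚ excess (hs ℓ) i) → a ≤ℚ ∣ countMin hs i - zipf i ∣
error-greatest {k} hs i a 1≤k a≤X = subst (a ≤ℚ_) (sym (∣error∣ hs i 1≤k))
  (subst (_≤ℚ countMin hs i - zipf i) (lemma (zipf i) a) (ℚP.+-monoˡ-≤ (ℚ.- zipf i)
    (minOver-greatest k _ (zipf i + a) 1≤k λ ℓ →
      subst (zipf i + a ≤ℚ_) (sym (bucketMass-excess (hs ℓ) i)) (ℚP.+-monoʳ-≤ (zipf i) (a≤X ℓ)))))
  where
  lemma : ∀ z a → z + a - z ≡ a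
  lemma = solve-∀ ℚ-ring

error-lower : ∀ {k n B} (hs : Fin k → Fin n → Fin B) i ℓ → 1 ≤ k →
  ∣ countMin hs i - zipf i ∣ ≤ℚ excess (hs ℓ) i
error-lower {k} hs i ℓ 1≤k = subst (_≤ℚ excess (hs ℓ) i) (sym (∣error∣ hs i 1≤k))
  (subst (countMin hs i - zipf i ≤ℚ_) (lemma (zipf i) (excess (hs ℓ) i)) (ℚP.+-monoˡ-≤ (ℚ.- zipf i)
    (subst (countMin hs i ≤ℚ_) (bucketMass-excess (hs ℓ) i) (minOver-lower k _ ℓ))))
  where
  lemma : ∀ z a → z + a - z ≡ a
  lemma = solve-∀ ℚ-ring

term≤∑ : ∀ n {f : Fin n → ℚ} → (∀ j → 0ℚ ≤ℚ f j) → ∀ j → f j ≤ℚ ∑ n f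
term≤∑ (suc n) {f} 0≤f zero = ≤-by-gap (∑ n (f ∘ suc)) (∑-nonneg n (0≤f ∘ suc)) refl
term≤∑ (suc n) {f} 0≤f (suc j) = ℚP.≤-trans (term≤∑ n (0≤f ∘ suc) j)
  (≤-by-gap (f zero) (0≤f zero) (ℚP.+-comm (f zero) _))

-- A union bound over the k tables: min_ℓ X(h_ℓ) ≥ A - Σ_ℓ Ψ(h_ℓ) holds pointwise.
expectedError-lower : ∀ k n B .{{_ : NonZero B}} → 1 ≤ k → (i : Fin n) →
  (A : ℚ) (Ψ : (Fin n → Fin B) → ℚ) → (∀ h → 0ℚ ≤ℚ Ψ h) → (∀ h → A - Ψ h ≤ℚ excess h i) →
  A - ι k * E (allHashes n B) Ψ ≤ℚ expectedError k n B i
expectedError-lower k n B 1≤k i A Ψ 0≤Ψ A-Ψ≤X =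
  subst (_≤ℚ expectedError k n B i) expectation (E-mono tuples pointwise)
  where
  open ≡-Reasoning
  tuples : List (Fin k → Fin n → Fin B)
  tuples = allHashTuples k n B
  pointwise : ∀ hs → A + (ℚ.- 1ℚ) * ∑ k (λ ℓ → Ψ (hs ℓ)) ≤ℚ ∣ countMin hs i - zipf i ∣
  pointwise hs = error-greatest hs i _ 1≤k λ ℓ → ℚP.≤-trans
    (≤-by-gap (∑ k (λ ℓ → Ψ (hs ℓ)) - Ψ (hs ℓ)) (0≤b-a (term≤∑ k (0≤Ψ ∘ hs) ℓ))
      (lemma A (Ψ (hs ℓ)) (∑ k (λ ℓ → Ψ (hs ℓ)))))
    (A-Ψ≤X (hs ℓ))
    where
    lemma : ∀ a x y → a - x ≡ a + (ℚ.- 1ℚ) * y + (y - x)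
    lemma = solve-∀ ℚ-ring
  expectation : E tuples (λ hs → A + (ℚ.- 1ℚ) * ∑ k (λ ℓ → Ψ (hs ℓ))) ≡ A - ι k * E (allHashes n B) Ψ
  expectation = begin
    E tuples (λ hs → A + (ℚ.- 1ℚ) * ∑ k (λ ℓ → Ψ (hs ℓ)))
      ≡⟨ E-+ tuples (λ _ → A) (λ hs → (ℚ.- 1ℚ) * ∑ k (λ ℓ → Ψ (hs ℓ))) ⟩
    E tuples (λ _ → A) + E tuples (λ hs → (ℚ.- 1ℚ) * ∑ k (λ ℓ → Ψ (hs ℓ)))
      ≡⟨ cong₂ _+_ (E-const tuples (allFunsOf-IsProb (allHashes-IsProb B n) k) A)
           (E-*ˡ tuples (ℚ.- 1ℚ) (λ hs → ∑ k (λ ℓ → Ψ (hs ℓ)))) ⟩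
    A + (ℚ.- 1ℚ) * E tuples (λ hs → ∑ k (λ ℓ → Ψ (hs ℓ)))
      ≡⟨ cong (λ z → A + (ℚ.- 1ℚ) * z) (trans (E-∑ tuples k (λ hs ℓ → Ψ (hs ℓ)))
           (trans (∑-cong k (λ ℓ → E-marginal (allHashes-IsProb B n) ℓ Ψ))
             (∑-const k (E (allHashes n B) Ψ)))) ⟩
    A + (ℚ.- 1ℚ) * (ι k * E (allHashes n B) Ψ)
      ≡⟨ lemma A (ι k * E (allHashes n B) Ψ) ⟩
    A - ι k * E (allHashes n B) Ψ ∎
    where
    lemma : ∀ a x → a + (ℚ.- 1ℚ) * x ≡ a - x
    lemma = solve-∀ ℚ-ring

-- All tables but the first two are dropped. The product `f h * f h′` is the part of the bound that
-- independence averages factor by factor; `g` is treated by linearity.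
expectedError-upper : ∀ k n B .{{_ : NonZero B}} → (i : Fin n) →
  (f g : (Fin n → Fin B) → ℚ) →
  (∀ h h′ → excess h i ⊓ excess h′ i ≤ℚ f h * f h′ + (g h + g h′)) →
  expectedError (suc (suc k)) n B i ≤ℚ
    E (allHashes n B) f * E (allHashes n B) f + (E (allHashes n B) g + E (allHashes n B) g)
expectedError-upper k n B i f g X⊓X≤ =
  subst (expectedError (suc (suc k)) n B i ≤ℚ_) expectation (E-mono tuples pointwise)
  where
  open ≡-Reasoning
  tuples : List (Fin (suc (suc k)) → Fin n → Fin B)
  tuples = allHashTuples (suc (suc k)) n B
  prob : IsProb (allHashes n B)
  prob = allHashes-IsProb B n
  one : Fin (suc (suc k))
  one = suc zero
  pointwise : ∀ hs → ∣ countMin hs i - zipf i ∣ ≤ℚ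
              f (hs zero) * f (hs one) + (g (hs zero) + g (hs one))
  pointwise hs = ℚP.≤-trans
    (ℚP.⊓-glb (error-lower hs i zero (s≤s z≤n)) (error-lower hs i one (s≤s z≤n)))
    (X⊓X≤ (hs zero) (hs one))
  expectation : E tuples (λ hs → f (hs zero) * f (hs one) + (g (hs zero) + g (hs one))) ≡
    E (allHashes n B) f * E (allHashes n B) f + (E (allHashes n B) g + E (allHashes n B) g)
  expectation = begin
    E tuples (λ hs → f (hs zero) * f (hs one) + (g (hs zero) + g (hs one)))
      ≡⟨ E-+ tuples (λ hs → f (hs zero) * f (hs one)) (λ hs → g (hs zero) + g (hs one)) ⟩
    E tuples (λ hs → f (hs zero) * f (hs one)) + E tuples (λ hs → g (hs zero) + g (hs one))
      ≡⟨ cong₂ _+_ (E-independent {xs = allHashes n B} prob k f f) (trans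
           (E-+ tuples (λ hs → g (hs zero)) (λ hs → g (hs one)))
           (cong₂ _+_ (E-marginal {xs = allHashes n B} prob {suc (suc k)} zero g) (E-marginal {xs = allHashes n B} prob {suc (suc k)} one g))) ⟩
    E (allHashes n B) f * E (allHashes n B) f + (E (allHashes n B) g + E (allHashes n B) g) ∎

-- Prefix indicators, powers and product identities

-- below L j is the indicator of j < L.
below : ℕ → ℕ → ℚ
below zero    j       = 0ℚ
below (suc L) zero    = 1ℚ
below (suc L) (suc j) = below L j

below-01 : ∀ L j (P : ℚ → Set) → P 0ℚ → P 1ℚ → P (below L j)
below-01 zero    j       P p₀ p₁ = p₀
below-01 (suc L) zero    P p₀ p₁ = p₁
below-01 (suc L) (suc j) P p₀ p₁ = below-01 L j P p₀ p₁

below-< : ∀ L j → j ℕ.< L → below L j ≡ 1ℚ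
below-< (suc L) zero    j<L       = refl
below-< (suc L) (suc j) (s≤s j<L) = below-< L j j<L

below-≥ : ∀ L j → L ≤ j → below L j ≡ 0ℚ
below-≥ zero    j       L≤j       = refl
below-≥ (suc L) (suc j) (s≤s L≤j) = below-≥ L j L≤j

0≤below : ∀ L j → 0ℚ ≤ℚ below L j
0≤below L j = below-01 L j (0ℚ ≤ℚ_) ℚP.≤-refl 0≤1

below≤1 : ∀ L j → below L j ≤ℚ 1ℚ
below≤1 L j = below-01 L j (_≤ℚ 1ℚ) 0≤1 ℚP.≤-refl

∑-below : ∀ n L → ∑ n (λ j → below L (toℕ j)) ≤ℚ ι L
∑-below zero    L       = 0≤ι L
∑-below (suc n) zero    = ℚP.≤-reflexive (trans (∑-const (suc n) 0ℚ) (ℚP.*-zeroʳ (ι (suc n))))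
∑-below (suc n) (suc L) = ℚP.+-monoʳ-≤ 1ℚ (∑-below n L)

pow : ℚ → ℕ → ℚ
pow q zero    = 1ℚ
pow q (suc n) = q * pow q n

pow-nonneg : ∀ {q} n → 0ℚ ≤ℚ q → 0ℚ ≤ℚ pow q n
pow-nonneg zero    0≤q = 0≤1
pow-nonneg (suc n) 0≤q = *-nonneg 0≤q (pow-nonneg n 0≤q)

pow-mono : ∀ {p q} n → 0ℚ ≤ℚ p → p ≤ℚ q → pow p n ≤ℚ pow q n
pow-mono zero    0≤p p≤q = ℚP.≤-refl
pow-mono (suc n) 0≤p p≤q =
  *-mono-≤ 0≤p (pow-nonneg n (ℚP.≤-trans 0≤p p≤q)) p≤q (pow-mono n 0≤p p≤q)

pow-+ : ∀ q m n → pow q (m ℕ.+ n) ≡ pow q m * pow q n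
pow-+ q zero    n = sym (ℚP.*-identityˡ _)
pow-+ q (suc m) n = trans (cong (q *_) (pow-+ q m n)) (sym (ℚP.*-assoc q _ _))

pow-* : ∀ q m n → pow q (m ℕ.* n) ≡ pow (pow q n) m
pow-* q zero    n = refl
pow-* q (suc m) n = trans (pow-+ q n (m ℕ.* n)) (cong (pow q n *_) (pow-* q m n))

pow-½ : ∀ n → ι (2 ℕ.^ n) * pow ½ n ≡ 1ℚ
pow-½ zero    = refl
pow-½ (suc n) = trans (cong (_* (½ * pow ½ n)) (ι-* 2 (2 ℕ.^ n)))
  (trans (lemma (ι (2 ℕ.^ n)) (pow ½ n)) (pow-½ n))
  where
  lemma : ∀ a b → (1ℚ + (1ℚ + 0ℚ)) * a * (½ * b) ≡ a * b
  lemma = solve-∀ ℚ-ring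

∏-below : ∀ n L c → L ≤ n → ∏ n (λ j → 1ℚ - c * below L (toℕ j)) ≡ pow (1ℚ - c) L
∏-below zero    zero    c L≤n = refl
∏-below (suc n) zero    c L≤n = trans (cong ((1ℚ - c * 0ℚ) *_) (∏-below n zero c z≤n)) (lemma c)
  where
  lemma : ∀ c → (1ℚ - c * 0ℚ) * 1ℚ ≡ 1ℚ
  lemma = solve-∀ ℚ-ring
∏-below (suc n) (suc L) c (s≤s L≤n) =
  cong₂ _*_ (cong (λ z → 1ℚ - z) (ℚP.*-identityʳ c)) (∏-below n L c L≤n)

-- `E-∏-coll` yields a product without a factor for `i`. Restoring that factor removes the
-- dependence on the position of `i`, so that `∏-below` can evaluate the result.
∏-other : ∀ {n} (i : Fin n) (θ : Fin n → ℚ) x →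
  ∏ n (λ j → 1ℚ - θ j * (other i j * x)) * (1ℚ - θ i * x) ≡ ∏ n (λ j → 1ℚ - θ j * x)
∏-other {suc n} zero θ x = trans
  (cong (λ z → (1ℚ - θ zero * (0ℚ * x)) * z * (1ℚ - θ zero * x))
    (∏-cong n (λ j → cong (λ z → 1ℚ - θ (suc j) * z) (ℚP.*-identityˡ x))))
  (lemma (θ zero) x (∏ n (λ j → 1ℚ - θ (suc j) * x)))
  where
  lemma : ∀ t x p → (1ℚ - t * (0ℚ * x)) * p * (1ℚ - t * x) ≡ (1ℚ - t * x) * p
  lemma = solve-∀ ℚ-ring
∏-other {suc n} (suc i) θ x = trans
  (lemma (θ zero) x _ (1ℚ - θ (suc i) * x))
  (cong ((1ℚ - θ zero * x) *_) (∏-other i (θ ∘ suc) x))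
  where
  lemma : ∀ t x p q → (1ℚ - t * (1ℚ * x)) * p * q ≡ (1ℚ - t * x) * (p * q)
  lemma = solve-∀ ℚ-ring

-- A division-free form of (1 - y)^n ≤ 1 / (1 + n y), standing in for exponential decay: at n y = 1
-- it gives a factor ½, and iterating that gives powers of ½.
pow-bernoulli : ∀ n y → 0ℚ ≤ℚ y → y ≤ℚ 1ℚ → pow (1ℚ - y) n * (1ℚ + ι n * y) ≤ℚ 1ℚ
pow-bernoulli zero    y 0≤y y≤1 = ℚP.≤-reflexive (lemma y)
  where
  lemma : ∀ y → 1ℚ * (1ℚ + 0ℚ * y) ≡ 1ℚ
  lemma = solve-∀ ℚ-ring
pow-bernoulli (suc n) y 0≤y y≤1 = ℚP.≤-trans
  (≤-by-gap (pow (1ℚ - y) n * (y * (y + ι n * y)))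
    (*-nonneg (pow-nonneg n (0≤b-a y≤1)) (*-nonneg 0≤y (+-nonneg 0≤y (*-nonneg (0≤ι n) 0≤y))))
    (lemma (pow (1ℚ - y) n) y (ι n)))
  (pow-bernoulli n y 0≤y y≤1)
  where
  lemma : ∀ p y x → p * (1ℚ + x * y) ≡ (1ℚ - y) * p * (1ℚ + (1ℚ + x) * y) + p * (y * (y + x * y))
  lemma = solve-∀ ℚ-ring

-- Lower bound for large n / B

Is01 : ℚ → Set
Is01 x = x ≡ 0ℚ ⊎ x ≡ 1ℚ

coll-Is01 : ∀ {n B} (h : Fin n → Fin B) i j → Is01 (coll h i j)
coll-Is01 h i j = coll-01 h i j Is01 (inj₁ refl) (inj₂ refl)

below*coll-Is01 : ∀ {n B} L (h : Fin n → Fin B) i j → Is01 (below L (toℕ j) * coll h i j)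
below*coll-Is01 L h i j = below-01 L (toℕ j) (λ b → Is01 (b * coll h i j))
  (inj₁ (ℚP.*-zeroˡ (coll h i j)))
  (subst Is01 (sym (ℚP.*-identityˡ (coll h i j))) (coll-Is01 h i j))

0≤Is01 : ∀ {x} → Is01 x → 0ℚ ≤ℚ x
0≤Is01 (inj₁ refl) = ℚP.≤-refl
0≤Is01 (inj₂ refl) = 0≤1

0≤1-½* : ∀ {w} → Is01 w → 0ℚ ≤ℚ 1ℚ - ½ * w
0≤1-½* (inj₁ refl) = 0≤1
0≤1-½* (inj₂ refl) = 0≤½

1+n≤2^n : ∀ n → suc n ≤ 2 ℕ.^ n
1+n≤2^n zero    = ℕP.≤-refl
1+n≤2^n (suc n) = ℕP.+-mono-≤ (ℕP.m^n>0 2 n) (subst (suc n ≤_) (sym (ℕP.+-identityʳ (2 ℕ.^ n))) (1+n≤2^n n))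

-- With Y = Σ w this is 2^(s - Y) ≥ 1 + (s - Y).
count-lower : ∀ n s (w : Fin n → ℚ) → (∀ j → Is01 (w j)) →
  1ℚ + ι s - ∑ n w ≤ℚ ι (2 ℕ.^ s) * ∏ n (λ j → 1ℚ - ½ * w j)
count-lower zero    s w w01 = subst (_≤ℚ ι (2 ℕ.^ s) * 1ℚ) (sym (ℚP.+-identityʳ (ι (suc s))))
  (subst (ι (suc s) ≤ℚ_) (sym (ℚP.*-identityʳ (ι (2 ℕ.^ s)))) (ι-mono (1+n≤2^n s)))
count-lower (suc n) s w w01 with w zero | w01 zero
... | _ | inj₁ refl = subst₂ _≤ℚ_ (lemma₁ (ι s) (∑ n (w ∘ suc))) (lemma₂ (ι (2 ℕ.^ s)) rest)
  (count-lower n s (w ∘ suc) (w01 ∘ suc))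
  where
  rest : ℚ
  rest = ∏ n (λ j → 1ℚ - ½ * w (suc j))
  lemma₁ : ∀ a y → 1ℚ + a - y ≡ 1ℚ + a - (0ℚ + y)
  lemma₁ = solve-∀ ℚ-ring
  lemma₂ : ∀ u p → u * p ≡ u * ((1ℚ - ½ * 0ℚ) * p)
  lemma₂ = solve-∀ ℚ-ring
count-lower (suc n) zero w w01 | _ | inj₂ refl = ℚP.≤-trans
  (≤-by-gap (∑ n (w ∘ suc)) (∑-nonneg n (λ j → 0≤Is01 (w01 (suc j)))) (lemma (∑ n (w ∘ suc))))
  (*-nonneg 0≤1 (*-nonneg 0≤½ (∏-nonneg n (λ j → 0≤1-½* (w01 (suc j))))))
  where
  lemma : ∀ y → 0ℚ ≡ 1ℚ + 0ℚ - (1ℚ + y) + y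
  lemma = solve-∀ ℚ-ring
count-lower (suc n) (suc s) w w01 | _ | inj₂ refl =
  subst₂ _≤ℚ_ (lemma₁ (ι s) (∑ n (w ∘ suc))) (trans (lemma₂ (ι (2 ℕ.^ s)) rest)
    (cong (_* (½ * rest)) (sym (ι-* 2 (2 ℕ.^ s)))))
  (count-lower n s (w ∘ suc) (w01 ∘ suc))
  where
  rest : ℚ
  rest = ∏ n (λ j → 1ℚ - ½ * w (suc j))
  lemma₁ : ∀ a y → 1ℚ + a - y ≡ 1ℚ + (1ℚ + a) - (1ℚ + y)
  lemma₁ = solve-∀ ℚ-ring
  lemma₂ : ∀ u p → u * p ≡ (1ℚ + (1ℚ + 0ℚ)) * u * (½ * p)
  lemma₂ = solve-∀ ℚ-ring

-- As ½ `w r` equals `w (suc r)`, the unrestricted sum telescopes below `w 0`.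
∑-geometric : ∀ d (w : ℕ → ℚ) (L : ℕ → ℕ) j → (∀ r → 0ℚ ≤ℚ w r) →
  (∀ r → w r ≡ w (suc r) + w (suc r)) →
  ∑ d (λ r → ½ * w (toℕ r) * below (L (toℕ r)) j) ≤ℚ w 0
∑-geometric zero    w L j 0≤w halves = 0≤w 0
∑-geometric (suc d) w L j 0≤w halves = ℚP.≤-trans
  (ℚP.+-mono-≤ (*-mono-≤ˡ (½ * w 0) (*-nonneg 0≤½ (0≤w 0)) (below≤1 (L 0) j))
    (∑-geometric d (w ∘ suc) (L ∘ suc) j (0≤w ∘ suc) (halves ∘ suc)))
  (ℚP.≤-reflexive (trans (cong (λ z → ½ * z * 1ℚ + w 1) (halves 0)) (trans (lemma (w 1)) (sym (halves 0)))))
  where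
  lemma : ∀ a → ½ * (a + a) * 1ℚ + a ≡ a + a
  lemma = solve-∀ ℚ-ring

-- Terms with `L r` ≤ j vanish. From the first r with j < `L r` on, the sum is at most `w r`, hence
-- at most z.
∑-geometric-≤ : ∀ d (w : ℕ → ℚ) (L : ℕ → ℕ) j z → 0ℚ ≤ℚ z → (∀ r → 0ℚ ≤ℚ w r) →
  (∀ r → w r ≡ w (suc r) + w (suc r)) → (∀ r → j ℕ.< L r → w r ≤ℚ z) →
  ∑ d (λ r → ½ * w (toℕ r) * below (L (toℕ r)) j) ≤ℚ z
∑-geometric-≤ zero    w L j z 0≤z 0≤w halves w≤z = 0≤z
∑-geometric-≤ (suc d) w L j z 0≤z 0≤w halves w≤z with ℕP.<-≤-connex j (L 0)
... | inj₁ j<L = ℚP.≤-trans (∑-geometric (suc d) w L j 0≤w halves) (w≤z 0 j<L)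
... | inj₂ L≤j = subst (_≤ℚ z)
  (sym (trans (cong (λ b → ½ * w 0 * b + rest) (below-≥ (L 0) j L≤j)) (lemma (½ * w 0) rest)))
  (∑-geometric-≤ d (w ∘ suc) (L ∘ suc) j z 0≤z (0≤w ∘ suc) (halves ∘ suc) (w≤z ∘ suc))
  where
  rest : ℚ
  rest = ∑ d (λ r → ½ * w (suc (toℕ r)) * below (L (suc (toℕ r))) j)
  lemma : ∀ a b → a * 0ℚ + b ≡ b
  lemma = solve-∀ ℚ-ring

-≤-by-+ : ∀ {a b c} → a ≤ℚ b + c → a - c ≤ℚ b
-≤-by-+ {a} {b} {c} a≤b+c = subst (a - c ≤ℚ_) (lemma b c) (ℚP.+-monoˡ-≤ (ℚ.- c) a≤b+c)
  where
  lemma : ∀ b c → b + c - c ≡ b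
  lemma = solve-∀ ℚ-ring

≤-+-by-- : ∀ {a b c} → a - c ≤ℚ b → a ≤ℚ b + c
≤-+-by-- {a} {b} {c} a-c≤b = subst (_≤ℚ b + c) (lemma a c) (ℚP.+-monoˡ-≤ c a-c≤b)
  where
  lemma : ∀ a c → a - c + c ≡ a
  lemma = solve-∀ ℚ-ring

module _ (B : ℕ) .{{_ : NonZero B}} where

  scale : ℕ → ℕ
  scale m = 2 ℕ.^ m ℕ.* B

  -- The reciprocal of `scale m`, written as a product so that halving it is a ring identity.
  scale⁻¹ : ℕ → ℚ
  scale⁻¹ m = inv B * pow ½ m

  0≤scale⁻¹ : ∀ m → 0ℚ ≤ℚ scale⁻¹ m
  0≤scale⁻¹ m = *-nonneg (0≤inv B) (pow-nonneg m 0≤½)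

  scale⁻¹-halves : ∀ m → scale⁻¹ m ≡ scale⁻¹ (suc m) + scale⁻¹ (suc m)
  scale⁻¹-halves m = lemma (inv B) (pow ½ m)
    where
    lemma : ∀ x p → x * p ≡ x * (½ * p) + x * (½ * p)
    lemma = solve-∀ ℚ-ring

  scale*scale⁻¹ : ∀ m → ι (scale m) * scale⁻¹ m ≡ 1ℚ
  scale*scale⁻¹ m = begin
    ι (scale m) * scale⁻¹ m                         ≡⟨ cong (_* scale⁻¹ m) (ι-* (2 ℕ.^ m) B) ⟩
    ι (2 ℕ.^ m) * ι B * (inv B * pow ½ m)           ≡⟨ lemma (ι (2 ℕ.^ m)) (ι B) (inv B) (pow ½ m) ⟩
    (ι (2 ℕ.^ m) * pow ½ m) * (ι B * inv B)         ≡⟨ cong₂ _*_ (pow-½ m) (ι*inv B) ⟩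
    1ℚ ∎
    where
    open ≡-Reasoning
    lemma : ∀ a b x p → a * b * (x * p) ≡ (a * p) * (b * x)
    lemma = solve-∀ ℚ-ring

  scale⁻¹≤inv : ∀ m j .{{_ : NonZero j}} → j ≤ scale m → scale⁻¹ m ≤ℚ inv j
  scale⁻¹≤inv m j j≤ = subst (scale⁻¹ m ≤ℚ_) (ℚP.*-identityʳ (inv j)) (≤-by-cross j
    (subst (ι j * scale⁻¹ m ≤ℚ_) (scale*scale⁻¹ m) (*-mono-≤ʳ (scale⁻¹ m) (0≤scale⁻¹ m) (ι-mono j≤))))

  inv≤scale⁻¹ : ∀ m j .{{_ : NonZero j}} → scale m ≤ j → inv j ≤ℚ scale⁻¹ m
  inv≤scale⁻¹ m j ≤j = subst₂ _≤ℚ_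
    (trans (lemma (ι (scale m)) (scale⁻¹ m) (inv j)) (trans (cong (_* inv j) (scale*scale⁻¹ m)) (ℚP.*-identityˡ (inv j))))
    (trans (lemma′ (ι j) (scale⁻¹ m) (inv j)) (trans (cong (_* scale⁻¹ m) (ι*inv j)) (ℚP.*-identityˡ (scale⁻¹ m))))
    (*-mono-≤ʳ (scale⁻¹ m * inv j) (*-nonneg (0≤scale⁻¹ m) (0≤inv j)) (ι-mono ≤j))
    where
    lemma : ∀ a b c → a * (b * c) ≡ a * b * c
    lemma = solve-∀ ℚ-ring
    lemma′ : ∀ a b c → a * (b * c) ≡ a * c * b
    lemma′ = solve-∀ ℚ-ring

  inv≤1 : inv B ≤ℚ 1ℚ
  inv≤1 = inv-anti 1 B (ℕ.>-nonZero⁻¹ B)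

  module _ {n : ℕ} (i : Fin n) where

    -- This is 2^(-Y) for the number Y of collisions among the first `L` items, since 1 - w/2 =
    -- 2^(-w) for w in {0, 1}. As a product it can be averaged by `E-∏-coll`.
    missProduct : ℕ → (Fin n → Fin B) → ℚ
    missProduct L h = ∏ n (λ j → 1ℚ - ½ * (below L (toℕ j) * coll h i j))

    0≤missProduct : ∀ L h → 0ℚ ≤ℚ missProduct L h
    0≤missProduct L h = ∏-nonneg n (λ j → 0≤1-½* (below*coll-Is01 L h i j))

    -- The power on the right includes a factor for `i` itself if `i` is among the first `L` items,
    -- while the expectation does not. That factor is at least ½, hence the ½ on the left.
    E-missProduct : ∀ L → L ≤ n →
      E (allHashes n B) (missProduct L) * ½ ≤ℚ pow (1ℚ - ½ * inv B) L
    E-missProduct L L≤n = ℚP.≤-trans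
      (*-mono-≤ˡ (E (allHashes n B) (missProduct L)) 0≤E ½≤)
      (ℚP.≤-reflexive (begin
        E (allHashes n B) (missProduct L) * (1ℚ - θ i * inv B)
          ≡⟨ cong (_* (1ℚ - θ i * inv B)) (trans
               (E-cong (allHashes n B) (λ h → ∏-cong n (λ j →
                 cong (λ z → 1ℚ - z) (sym (ℚP.*-assoc ½ (below L (toℕ j)) (coll h i j))))))
               (E-∏-coll B i θ)) ⟩
        ∏ n (λ j → 1ℚ - θ j * (other i j * inv B)) * (1ℚ - θ i * inv B)
          ≡⟨ ∏-other i θ (inv B) ⟩
        ∏ n (λ j → 1ℚ - θ j * inv B)
          ≡⟨ ∏-cong n (λ j → lemma ½ (below L (toℕ j)) (inv B)) ⟩
        ∏ n (λ j → 1ℚ - ½ * inv B * below L (toℕ j))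
          ≡⟨ ∏-below n L (½ * inv B) L≤n ⟩
        pow (1ℚ - ½ * inv B) L ∎))
      where
      open ≡-Reasoning
      θ : Fin n → ℚ
      θ j = ½ * below L (toℕ j)
      0≤E : 0ℚ ≤ℚ E (allHashes n B) (missProduct L)
      0≤E = subst (_≤ℚ E (allHashes n B) (missProduct L))
        (E-const (allHashes n B) (allHashes-IsProb B n) 0ℚ)
        (E-mono (allHashes n B) (0≤missProduct L))
      lemma : ∀ c b x → 1ℚ - c * b * x ≡ 1ℚ - c * x * b
      lemma = solve-∀ ℚ-ring
      ½≤ : ½ ≤ℚ 1ℚ - θ i * inv B
      ½≤ = ≤-by-gap (½ * (1ℚ - below L (toℕ i) * inv B))
        (*-nonneg 0≤½ (0≤b-a (*-mono-≤ {b = 1ℚ} {d = 1ℚ} (0≤below L (toℕ i)) 0≤1 (below≤1 L (toℕ i)) inv≤1)))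
        (lemma₂ (below L (toℕ i)) (inv B))
        where
        lemma₂ : ∀ b x → 1ℚ - ½ * b * x ≡ ½ + ½ * (1ℚ - b * x)
        lemma₂ = solve-∀ ℚ-ring

    pow-2B : pow (1ℚ - ½ * inv B) (2 ℕ.* B) ≤ℚ ½
    pow-2B = subst₂ _≤ℚ_ (trans (cong (λ z → ½ * (p * (1ℚ + z))) eq) (lemma p)) (ℚP.*-identityʳ ½)
      (*-mono-≤ˡ ½ 0≤½ (pow-bernoulli (2 ℕ.* B) (½ * inv B) (*-nonneg 0≤½ (0≤inv B))
        (*-mono-≤ {b = 1ℚ} {d = 1ℚ} 0≤½ 0≤1 ½≤1 inv≤1)))
      where
      p : ℚ
      p = pow (1ℚ - ½ * inv B) (2 ℕ.* B)
      ½≤1 : ½ ≤ℚ 1ℚ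
      ½≤1 = ≤-by-gap ½ 0≤½ refl
      lemma′ : ∀ b x → (1ℚ + (1ℚ + 0ℚ)) * b * (½ * x) ≡ b * x
      lemma′ = solve-∀ ℚ-ring
      eq : ι (2 ℕ.* B) * (½ * inv B) ≡ 1ℚ
      eq = trans (cong (_* (½ * inv B)) (ι-* 2 B)) (trans (lemma′ (ι B) (inv B)) (ι*inv B))
      lemma : ∀ p → ½ * (p * (1ℚ + 1ℚ)) ≡ p
      lemma = solve-∀ ℚ-ring

    -- `scale (2 ℕ.+ t)` consists of 2 · 2^t runs of 2B items, and each run gains a factor ½ by
    -- `pow-2B`. The exponent is twice s = 2^t: one half pays for the factor 2^s of `deficit`, the
    -- other for the k tables.
    E-missProduct-scale : ∀ t → scale (2 ℕ.+ t) ≤ n →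
      E (allHashes n B) (missProduct (scale (2 ℕ.+ t))) * ½ ≤ℚ pow ½ (2 ℕ.^ t) * pow ½ (2 ℕ.^ t)
    E-missProduct-scale t L≤n = ℚP.≤-trans (E-missProduct (scale (2 ℕ.+ t)) L≤n)
      (subst₂ _≤ℚ_ (trans (sym (pow-* q (u ℕ.+ u) (2 ℕ.* B))) (cong (pow q) (eq u B))) (pow-+ ½ u u)
        (pow-mono (u ℕ.+ u) (pow-nonneg (2 ℕ.* B) 0≤q) pow-2B))
      where
      u : ℕ
      u = 2 ℕ.^ t
      q : ℚ
      q = 1ℚ - ½ * inv B
      0≤q : 0ℚ ≤ℚ q
      0≤q = 0≤b-a (*-mono-≤ {b = 1ℚ} {d = 1ℚ} 0≤½ 0≤1 (≤-by-gap ½ 0≤½ refl) inv≤1)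
      eq : ∀ u B → (u ℕ.+ u) ℕ.* (2 ℕ.* B) ≡ 2 ℕ.* (2 ℕ.* u) ℕ.* B
      eq = ℕ-solve-∀

    deficit : ℕ → (Fin n → Fin B) → ℚ
    deficit t h = ι (2 ℕ.^ (2 ℕ.^ t)) * missProduct (scale (2 ℕ.+ t)) h

    -- The 2 in `2 ℕ.* k` compensates for the ½ lost at item `i`.
    k*E-deficit≤1 : ∀ k t → scale (2 ℕ.+ t) ≤ n → 2 ℕ.* k ≤ 2 ℕ.^ (2 ℕ.^ t) →
      ι k * E (allHashes n B) (deficit t) ≤ℚ 1ℚ
    k*E-deficit≤1 k t L≤n 2k≤ = begin
      ι k * E (allHashes n B) (deficit t)
        ≡⟨ cong (ι k *_) (E-*ˡ (allHashes n B) U (missProduct (scale (2 ℕ.+ t)))) ⟩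
      ι k * (U * P)
        ≡⟨ lemma (ι k) U P ⟩
      ι 2 * ι k * U * (P * ½)
        ≡⟨ cong (λ z → z * U * (P * ½)) (ι-* 2 k) ⟨
      ι (2 ℕ.* k) * U * (P * ½)
        ≤⟨ *-mono-≤ˡ (ι (2 ℕ.* k) * U) (*-nonneg (0≤ι (2 ℕ.* k)) (0≤ι (2 ℕ.^ (2 ℕ.^ t)))) (E-missProduct-scale t L≤n) ⟩
      ι (2 ℕ.* k) * U * (q * q)
        ≡⟨ lemma′ (ι (2 ℕ.* k)) U q ⟩
      ι (2 ℕ.* k) * q * (U * q)
        ≡⟨ cong (ι (2 ℕ.* k) * q *_) (pow-½ (2 ℕ.^ t)) ⟩
      ι (2 ℕ.* k) * q * 1ℚ
        ≡⟨ ℚP.*-identityʳ (ι (2 ℕ.* k) * q) ⟩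
      ι (2 ℕ.* k) * q
        ≤⟨ *-mono-≤ʳ q (pow-nonneg (2 ℕ.^ t) 0≤½) (ι-mono 2k≤) ⟩
      U * q
        ≡⟨ pow-½ (2 ℕ.^ t) ⟩
      1ℚ ∎
      where
      open ℚP.≤-Reasoning
      U P q : ℚ
      U = ι (2 ℕ.^ (2 ℕ.^ t))
      P = E (allHashes n B) (missProduct (scale (2 ℕ.+ t)))
      q = pow ½ (2 ℕ.^ t)
      lemma : ∀ k u p → k * (u * p) ≡ (1ℚ + (1ℚ + 0ℚ)) * k * u * (p * ½)
      lemma = solve-∀ ℚ-ring
      lemma′ : ∀ k u q → k * u * (q * q) ≡ k * q * (u * q)
      lemma′ = solve-∀ ℚ-ring

    module _ (t₀ d : ℕ) where

      private
        block : Fin d → ℕ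
        block r = toℕ r ℕ.+ t₀

        -- Half the reciprocal of the scale. An item j is counted at every scale above it, and these
        -- weights sum geometrically to at most 1/j, so the combined counts stay below the excess.
        c : Fin d → ℚ
        c r = ½ * scale⁻¹ (2 ℕ.+ block r)

        0≤c : ∀ r → 0ℚ ≤ℚ c r
        0≤c r = *-nonneg 0≤½ (0≤scale⁻¹ (2 ℕ.+ block r))

        count : Fin d → (Fin n → Fin B) → ℚ
        count r h = ∑ n (λ j → below (scale (2 ℕ.+ block r)) (toℕ j) * coll h i j)

        u : Fin d → ℚ
        u r = ι (2 ℕ.^ block r)

        A : ℚ
        A = ∑ d (λ r → c r * (1ℚ + u r))

        Ψ : (Fin n → Fin B) → ℚ
        Ψ h = ∑ d (λ r → c r * deficit (block r) h)

      counts≤excess : ∀ h → ∑ d (λ r → c r * count r h) ≤ℚ excess h i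
      counts≤excess h = begin
        ∑ d (λ r → c r * count r h)
          ≡⟨ ∑-cong d (λ r → ∑-*ˡ n (c r) (λ j → b r j * coll h i j)) ⟨
        ∑ d (λ r → ∑ n (λ j → c r * (b r j * coll h i j)))
          ≡⟨ ∑-swap d n (λ r j → c r * (b r j * coll h i j)) ⟩
        ∑ n (λ j → ∑ d (λ r → c r * (b r j * coll h i j)))
          ≡⟨ ∑-cong n (λ j → trans (∑-cong d (λ r → lemma (c r) (b r j) (coll h i j)))
               (∑-*ˡ d (coll h i j) (λ r → c r * b r j))) ⟩
        ∑ n (λ j → coll h i j * ∑ d (λ r → c r * b r j))
          ≤⟨ ∑-mono n (λ j → *-mono-≤ˡ (coll h i j) (0≤coll h i j)
               (∑-geometric-≤ d (λ r → scale⁻¹ (2 ℕ.+ (r ℕ.+ t₀))) (λ r → scale (2 ℕ.+ (r ℕ.+ t₀))) (toℕ j) (zipf j)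
                 (0≤inv (suc (toℕ j))) (λ r → 0≤scale⁻¹ (2 ℕ.+ (r ℕ.+ t₀))) (λ r → scale⁻¹-halves (2 ℕ.+ (r ℕ.+ t₀)))
                 (λ r → scale⁻¹≤inv (2 ℕ.+ (r ℕ.+ t₀)) (suc (toℕ j))))) ⟩
        ∑ n (λ j → coll h i j * zipf j)
          ≡⟨ ∑-cong n (λ j → ℚP.*-comm (coll h i j) (zipf j)) ⟩
        excess h i ∎
        where
        open ℚP.≤-Reasoning
        b : Fin d → Fin n → ℚ
        b r j = below (scale (2 ℕ.+ block r)) (toℕ j)
        lemma : ∀ x y z → x * (y * z) ≡ z * (x * y)
        lemma = solve-∀ ℚ-ring

      excess-lower : ∀ h → A - Ψ h ≤ℚ excess h i
      excess-lower h = ℚP.≤-trans (-≤-by-+ {A} {∑ d (λ r → c r * count r h)} {Ψ h} (subst (A ≤ℚ_)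
        (∑-+ d (λ r → c r * count r h) (λ r → c r * deficit (block r) h))
        (∑-mono d (λ r → subst (c r * (1ℚ + u r) ≤ℚ_) (ℚP.*-distribˡ-+ (c r) (count r h) (deficit (block r) h))
          (*-mono-≤ˡ (c r) (0≤c r) (subst (1ℚ + u r ≤ℚ_) (ℚP.+-comm (deficit (block r) h) (count r h))
            (≤-+-by-- {1ℚ + u r} {deficit (block r) h} {count r h} (count-lower n (2 ℕ.^ block r) _ (below*coll-Is01 (scale (2 ℕ.+ block r)) h i)))))))))
        (counts≤excess h)

      -- The 1 in 1 + s - Y ≤ 2^(s - Y) absorbs the whole loss of the union bound, because k times
      -- the mean deficit is at most 1. What remains is `c r * u r`, which is 1/(8B) at every one of
      -- the `d` scales.
      expectedError-lower-log : ∀ k → 1 ≤ k → (∀ r → scale (2 ℕ.+ block r) ≤ n) →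
        2 ℕ.* k ≤ 2 ℕ.^ (2 ℕ.^ t₀) → ι d * (½ * ½ * ½ * inv B) ≤ℚ expectedError k n B i
      expectedError-lower-log k 1≤k L≤n 2k≤ = ℚP.≤-trans
        (subst (_≤ℚ A - ι k * E (allHashes n B) Ψ) (trans A-∑c (trans (∑-cong d c*u) (∑-const d (½ * ½ * ½ * inv B))))
          (ℚP.+-monoʳ-≤ A (ℚP.neg-antimono-≤ kEΨ≤)))
        (expectedError-lower k n B 1≤k i A Ψ
          (λ h → ∑-nonneg d (λ r → *-nonneg (0≤c r) (*-nonneg (0≤ι (2 ℕ.^ (2 ℕ.^ block r))) (0≤missProduct (scale (2 ℕ.+ block r)) h))))
          excess-lower)
        where
        open ℚP.≤-Reasoning
        kEΨ≤ : ι k * E (allHashes n B) Ψ ≤ℚ ∑ d c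
        kEΨ≤ = begin
          ι k * E (allHashes n B) Ψ
            ≡⟨ cong (ι k *_) (trans (E-∑ (allHashes n B) d (λ h r → c r * deficit (block r) h))
                 (∑-cong d (λ r → E-*ˡ (allHashes n B) (c r) (deficit (block r))))) ⟩
          ι k * ∑ d (λ r → c r * E (allHashes n B) (deficit (block r)))
            ≡⟨ ∑-*ˡ d (ι k) (λ r → c r * E (allHashes n B) (deficit (block r))) ⟨
          ∑ d (λ r → ι k * (c r * E (allHashes n B) (deficit (block r))))
            ≤⟨ ∑-mono d (λ r → subst₂ _≤ℚ_ (lemma (c r) (ι k) _) (ℚP.*-identityʳ (c r))
                 (*-mono-≤ˡ (c r) (0≤c r) (k*E-deficit≤1 k (block r) (L≤n r)
                   (ℕP.≤-trans 2k≤ (ℕP.^-monoʳ-≤ 2 (ℕP.^-monoʳ-≤ 2 (ℕP.m≤n+m t₀ (toℕ r)))))))) ⟩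
          ∑ d c ∎
          where
          lemma : ∀ c k e → c * (k * e) ≡ k * (c * e)
          lemma = solve-∀ ℚ-ring
        A-∑c : A - ∑ d c ≡ ∑ d (λ r → c r * u r)
        A-∑c = trans (cong (_- ∑ d c) (trans (∑-cong d (λ r → lemma (c r) (u r)))
          (∑-+ d (λ r → c r * u r) c))) (lemma′ (∑ d (λ r → c r * u r)) (∑ d c))
          where
          lemma : ∀ c u → c * (1ℚ + u) ≡ c * u + c
          lemma = solve-∀ ℚ-ring
          lemma′ : ∀ a b → a + b - b ≡ a
          lemma′ = solve-∀ ℚ-ring
        c*u : ∀ r → c r * u r ≡ ½ * ½ * ½ * inv B
        c*u r = trans (lemma (inv B) (pow ½ (block r)) (u r))
          (trans (cong (λ z → ½ * ½ * ½ * inv B * z) (pow-½ (block r))) (ℚP.*-identityʳ _))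
          where
          lemma : ∀ x p u → ½ * (x * (½ * (½ * p))) * u ≡ ½ * ½ * ½ * x * (u * p)
          lemma = solve-∀ ℚ-ring

-- Upper bound

-- A rational stand-in for the square root: (s + 1/s)² = s² + 2 + 1/s², so √ n * √ n grows linearly.
-- Its reciprocal increments make ∑ √⁻¹ telescope.
root : ℕ → Σ ℚ ℚ.Positive
root-recip : ℕ → Σ ℚ ℚ.Positive

root zero    = 1ℚ , _
root (suc n) = proj₁ (root n) + proj₁ (root-recip n) ,
  ℚP.pos+pos⇒pos (proj₁ (root n)) {{proj₂ (root n)}} (proj₁ (root-recip n)) {{proj₂ (root-recip n)}}

root-recip n = (ℚ.1/ proj₁ (root n)) {{ℚP.pos⇒nonZero (proj₁ (root n)) {{proj₂ (root n)}}}} ,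
  ℚP.1/pos⇒pos (proj₁ (root n)) {{proj₂ (root n)}}

√ : ℕ → ℚ
√ n = proj₁ (root n)

√⁻¹ : ℕ → ℚ
√⁻¹ n = proj₁ (root-recip n)

√*√⁻¹ : ∀ n → √ n * √⁻¹ n ≡ 1ℚ
√*√⁻¹ n = ℚP.*-inverseʳ (√ n) {{ℚP.pos⇒nonZero (√ n) {{proj₂ (root n)}}}}

0≤√ : ∀ n → 0ℚ ≤ℚ √ n
0≤√ n = ℚP.<⇒≤ (ℚP.positive⁻¹ (√ n) {{proj₂ (root n)}})

0≤√⁻¹ : ∀ n → 0ℚ ≤ℚ √⁻¹ n
0≤√⁻¹ n = ℚP.<⇒≤ (ℚP.positive⁻¹ (√⁻¹ n) {{proj₂ (root-recip n)}})

1≤√ : ∀ n → 1ℚ ≤ℚ √ n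
1≤√ zero    = ℚP.≤-refl
1≤√ (suc n) = ℚP.≤-trans (1≤√ n) (≤-by-gap (√⁻¹ n) (0≤√⁻¹ n) refl)

√⁻¹≤1 : ∀ n → √⁻¹ n ≤ℚ 1ℚ
√⁻¹≤1 n = subst₂ _≤ℚ_ (ℚP.*-identityˡ (√⁻¹ n)) (√*√⁻¹ n) (*-mono-≤ʳ (√⁻¹ n) (0≤√⁻¹ n) (1≤√ n))

√²-upper : ∀ n → √ n * √ n ≤ℚ 1ℚ + ι 3 * ι n
√²-upper zero    = ℚP.≤-refl
√²-upper (suc n) = begin
  (s + r) * (s + r)                         ≡⟨ lemma s r ⟩
  s * s + (s * r + s * r) + r * r           ≡⟨ cong (λ z → s * s + (z + z) + r * r) (√*√⁻¹ n) ⟩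
  s * s + (1ℚ + 1ℚ) + r * r                 ≤⟨ ℚP.+-mono-≤ (ℚP.+-monoˡ-≤ (1ℚ + 1ℚ) (√²-upper n))
                                                 (*-mono-≤ {b = 1ℚ} {d = 1ℚ} (0≤√⁻¹ n) 0≤1 (√⁻¹≤1 n) (√⁻¹≤1 n)) ⟩
  1ℚ + ι 3 * ι n + (1ℚ + 1ℚ) + 1ℚ * 1ℚ      ≡⟨ lemma′ (ι n) ⟩
  1ℚ + ι 3 * ι (suc n)                      ∎
  where
  open ℚP.≤-Reasoning
  s r : ℚ
  s = √ n
  r = √⁻¹ n
  lemma : ∀ s r → (s + r) * (s + r) ≡ s * s + (s * r + s * r) + r * r
  lemma = solve-∀ ℚ-ring
  lemma′ : ∀ x → 1ℚ + (1ℚ + (1ℚ + (1ℚ + 0ℚ))) * x + (1ℚ + 1ℚ) + 1ℚ * 1ℚ ≡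
                 1ℚ + (1ℚ + (1ℚ + (1ℚ + 0ℚ))) * (1ℚ + x)
  lemma′ = solve-∀ ℚ-ring

-- By `√²-upper` the square of `√ n` is at most 1 + 3n, hence at most 4(n + 1). This is the source
-- of the factor 2 in `root-weight`.
inv≤√⁻¹² : ∀ n → inv (suc n) ≤ℚ (ι 2 * √⁻¹ n) * (ι 2 * √⁻¹ n)
inv≤√⁻¹² n = subst₂ _≤ℚ_ (ℚP.*-identityʳ (inv (suc n))) eq
  (*-mono-≤ˡ (inv (suc n)) (0≤inv (suc n)) 1≤)
  where
  s r x : ℚ
  s = √ n
  r = √⁻¹ n
  x = ι n
  lemma₁ : ∀ s r → (s * s) * (r * r) ≡ (s * r) * (s * r)
  lemma₁ = solve-∀ ℚ-ring
  lemma₂ : ∀ x → (1ℚ + (1ℚ + (1ℚ + (1ℚ + 0ℚ)))) * (1ℚ + x) ≡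
                 1ℚ + (1ℚ + (1ℚ + (1ℚ + 0ℚ))) * x + ((1ℚ + (1ℚ + (1ℚ + 0ℚ))) + x)
  lemma₂ = solve-∀ ℚ-ring
  1≤ : 1ℚ ≤ℚ ι 4 * ι (suc n) * (r * r)
  1≤ = subst (_≤ℚ ι 4 * ι (suc n) * (r * r)) (trans (lemma₁ s r) (cong₂ _*_ (√*√⁻¹ n) (√*√⁻¹ n)))
    (*-mono-≤ʳ (r * r) (*-nonneg (0≤√⁻¹ n) (0≤√⁻¹ n)) (ℚP.≤-trans (√²-upper n)
      (≤-by-gap (ι 3 + x) (+-nonneg (0≤ι 3) (0≤ι n)) (lemma₂ x))))
  lemma₃ : ∀ z y r → z * ((1ℚ + (1ℚ + (1ℚ + (1ℚ + 0ℚ)))) * y * (r * r)) ≡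
                     y * z * (((1ℚ + (1ℚ + 0ℚ)) * r) * ((1ℚ + (1ℚ + 0ℚ)) * r))
  lemma₃ = solve-∀ ℚ-ring
  eq : inv (suc n) * (ι 4 * ι (suc n) * (r * r)) ≡ (ι 2 * r) * (ι 2 * r)
  eq = trans (lemma₃ (inv (suc n)) (ι (suc n)) r)
    (trans (cong (_* ((ι 2 * r) * (ι 2 * r))) (ι*inv (suc n))) (ℚP.*-identityˡ _))

-- The increments of `s` are summed over j < min(n, L); for n < L the missing ones are nonnegative.
∑-telescope : ∀ n L (s r : ℕ → ℚ) → (∀ j → 0ℚ ≤ℚ r j) → (∀ j → s (suc j) ≡ s j + r j) →
  ∑ n (λ j → r (toℕ j) * below L (toℕ j)) ≤ℚ s L - s 0
∑-telescope zero    zero    s r 0≤r step = ℚP.≤-reflexive (sym (ℚP.+-inverseʳ (s 0)))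
∑-telescope zero    (suc L) s r 0≤r step = ℚP.≤-trans (∑-telescope zero L (s ∘ suc) (r ∘ suc) (0≤r ∘ suc) (step ∘ suc))
  (≤-by-gap (r 0) (0≤r 0) (trans (lemma (s (suc L)) (s 0) (r 0)) (cong (λ z → s (suc L) - z + r 0) (sym (step 0)))))
  where
  lemma : ∀ a b c → a - b ≡ a - (b + c) + c
  lemma = solve-∀ ℚ-ring
∑-telescope (suc n) zero    s r 0≤r step = subst₂ _≤ℚ_
  (sym (trans (cong (λ z → z + rest) (ℚP.*-zeroʳ (r 0))) (ℚP.+-identityˡ rest)))
  (trans (ℚP.+-inverseʳ (s 1)) (sym (ℚP.+-inverseʳ (s 0))))
  (∑-telescope n zero (s ∘ suc) (r ∘ suc) (0≤r ∘ suc) (step ∘ suc))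
  where
  rest : ℚ
  rest = ∑ n (λ j → r (suc (toℕ j)) * 0ℚ)
∑-telescope (suc n) (suc L) s r 0≤r step = ℚP.≤-trans
  (ℚP.+-monoʳ-≤ (r 0 * 1ℚ) (∑-telescope n L (s ∘ suc) (r ∘ suc) (0≤r ∘ suc) (step ∘ suc)))
  (ℚP.≤-reflexive (trans (cong (λ z → r 0 * 1ℚ + (s (suc L) - z)) (step 0)) (lemma (s 0) (r 0) (s (suc L)))))
  where
  lemma : ∀ a b c → b * 1ℚ + (c - (a + b)) ≡ c - a
  lemma = solve-∀ ℚ-ring

-- If `L 0` ≤ j, some r satisfies `L r` ≤ j < `L (suc r)`, and its term alone is at least z.
-- Charging a layer to the whole prefix below `L (suc r)` costs only a constant factor when `L`
-- doubles.
layers : ∀ d (w : ℕ → ℚ) (L : ℕ → ℕ) j z → 0ℚ ≤ℚ z → (∀ r → 0ℚ ≤ℚ w r) →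
  (∀ r → L r ≤ j → z ≤ℚ w r) → j ℕ.< L d →
  z ≤ℚ z * below (L 0) j + ∑ d (λ r → w (toℕ r) * below (L (suc (toℕ r))) j)
layers zero    w L j z 0≤z 0≤w z≤w j<L = ℚP.≤-reflexive
  (trans (lemma z) (cong (λ b → z * b + 0ℚ) (sym (below-< (L 0) j j<L))))
  where
  lemma : ∀ z → z ≡ z * 1ℚ + 0ℚ
  lemma = solve-∀ ℚ-ring
layers (suc d) w L j z 0≤z 0≤w z≤w j<L = ℚP.≤-trans
  (layers d (w ∘ suc) (L ∘ suc) j z 0≤z (0≤w ∘ suc) (z≤w ∘ suc) j<L)
  (subst (z * b₁ + rest ≤ℚ_) (ℚP.+-assoc (z * b₀) (w 0 * b₁) rest) (ℚP.+-monoˡ-≤ rest head≤))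
  where
  b₀ b₁ rest : ℚ
  b₀ = below (L 0) j
  b₁ = below (L 1) j
  rest = ∑ d (λ r → w (suc (toℕ r)) * below (L (suc (suc (toℕ r)))) j)
  head≤ : z * b₁ ≤ℚ z * b₀ + w 0 * b₁
  head≤ with ℕP.<-≤-connex j (L 0)
  ... | inj₁ j<L₀ = ℚP.≤-trans (*-mono-≤ˡ z 0≤z (below≤1 (L 1) j))
    (≤-by-gap (w 0 * b₁) (*-nonneg (0≤w 0) (0≤below (L 1) j))
      (cong (λ b → z * b + w 0 * b₁) (below-< (L 0) j j<L₀)))
  ... | inj₂ L₀≤j = ℚP.≤-trans (*-mono-≤ʳ b₁ (0≤below (L 1) j) (z≤w 0 L₀≤j))
    (≤-by-gap (z * b₀) (*-nonneg 0≤z (0≤below (L 0) j)) (ℚP.+-comm (z * b₀) (w 0 * b₁)))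

∑-squares : ∀ n {a : Fin n → ℚ} → (∀ j → 0ℚ ≤ℚ a j) → ∑ n (λ j → a j * a j) ≤ℚ ∑ n a * ∑ n a
∑-squares zero    0≤a = ℚP.≤-refl
∑-squares (suc n) {a} 0≤a = ℚP.≤-trans (ℚP.+-monoʳ-≤ (a zero * a zero) (∑-squares n (0≤a ∘ suc)))
  (≤-by-gap (a zero * y + a zero * y) (+-nonneg 0≤ay 0≤ay) (lemma (a zero) y))
  where
  y : ℚ
  y = ∑ n (a ∘ suc)
  0≤ay : 0ℚ ≤ℚ a zero * y
  0≤ay = *-nonneg (0≤a zero) (∑-nonneg n (0≤a ∘ suc))
  lemma : ∀ a y → (a + y) * (a + y) ≡ a * a + y * y + (a * y + a * y)
  lemma = solve-∀ ℚ-ring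

module _ (B : ℕ) .{{_ : NonZero B}} {n : ℕ} (i : Fin n) where

  E-linear : ∀ (a : Fin n → ℚ) → (∀ j → 0ℚ ≤ℚ a j) →
    E (allHashes n B) (λ h → ∑ n (λ j → a j * coll h i j)) ≤ℚ ∑ n a * inv B
  E-linear a 0≤a = begin
    E (allHashes n B) (λ h → ∑ n (λ j → a j * coll h i j))
      ≡⟨ E-∑ (allHashes n B) n (λ h j → a j * coll h i j) ⟩
    ∑ n (λ j → E (allHashes n B) (λ h → a j * coll h i j))
      ≡⟨ ∑-cong n (λ j → E-*ˡ (allHashes n B) (a j) (λ h → coll h i j)) ⟩
    ∑ n (λ j → a j * E (allHashes n B) (λ h → coll h i j))
      ≤⟨ ∑-mono n (λ j → *-mono-≤ˡ (a j) (0≤a j) (E-coll B i j)) ⟩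
    ∑ n (λ j → a j * inv B)
      ≡⟨ ∑-cong n (λ j → ℚP.*-comm (a j) (inv B)) ⟩
    ∑ n (λ j → inv B * a j)
      ≡⟨ ∑-*ˡ n (inv B) a ⟩
    inv B * ∑ n a
      ≡⟨ ℚP.*-comm (inv B) (∑ n a) ⟩
    ∑ n a * inv B ∎
    where open ℚP.≤-Reasoning

  private
    b : Fin n → ℚ
    b j = below B (toℕ j)

    root-weight tail-weight : Fin n → ℚ
    root-weight j = ι 2 * (√⁻¹ (toℕ j) * b j)
    tail-weight j = zipf j * (1ℚ - b j)

    0≤root-weight : ∀ j → 0ℚ ≤ℚ root-weight j
    0≤root-weight j = *-nonneg (0≤ι 2) (*-nonneg (0≤√⁻¹ (toℕ j)) (0≤below B (toℕ j)))

    0≤tail-weight : ∀ j → 0ℚ ≤ℚ tail-weight j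
    0≤tail-weight j = *-nonneg (0≤inv (suc (toℕ j))) (0≤b-a (below≤1 B (toℕ j)))

  rootMass tailMass : (Fin n → Fin B) → ℚ
  rootMass h = ∑ n (λ j → root-weight j * coll h i j)
  tailMass h = ∑ n (λ j → tail-weight j * coll h i j)

  0≤rootMass : ∀ h → 0ℚ ≤ℚ rootMass h
  0≤rootMass h = ∑-nonneg n (λ j → *-nonneg (0≤root-weight j) (0≤coll h i j))

  0≤tailMass : ∀ h → 0ℚ ≤ℚ tailMass h
  0≤tailMass h = ∑-nonneg n (λ j → *-nonneg (0≤tail-weight j) (0≤coll h i j))

  -- The square root is subadditive, so √(Σ_{j ≤ B} v_j / j) is at most about Σ_{j ≤ B} v_j / √j.
  excess≤rootMass²+tailMass : ∀ h → excess h i ≤ℚ rootMass h * rootMass h + tailMass h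
  excess≤rootMass²+tailMass h = begin
    excess h i
      ≡⟨ ∑-cong n (λ j → lemma (zipf j) (b j) (coll h i j)) ⟩
    ∑ n (λ j → zipf j * (b j * coll h i j) + tail-weight j * coll h i j)
      ≡⟨ ∑-+ n (λ j → zipf j * (b j * coll h i j)) (λ j → tail-weight j * coll h i j) ⟩
    ∑ n (λ j → zipf j * (b j * coll h i j)) + tailMass h
      ≤⟨ ℚP.+-monoˡ-≤ (tailMass h) (∑-mono n square) ⟩
    ∑ n (λ j → (root-weight j * coll h i j) * (root-weight j * coll h i j)) + tailMass h
      ≤⟨ ℚP.+-monoˡ-≤ (tailMass h) (∑-squares n (λ j → *-nonneg (0≤root-weight j) (0≤coll h i j))) ⟩
    rootMass h * rootMass h + tailMass h ∎
    where
    open ℚP.≤-Reasoning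
    lemma : ∀ z b v → z * v ≡ z * (b * v) + z * (1ℚ - b) * v
    lemma = solve-∀ ℚ-ring
    idem : ∀ {x} → Is01 x → x * x ≡ x
    idem (inj₁ refl) = refl
    idem (inj₂ refl) = refl
    lemma′ : ∀ r b v → ((1ℚ + (1ℚ + 0ℚ)) * r) * ((1ℚ + (1ℚ + 0ℚ)) * r) * ((b * v) * (b * v)) ≡
                       ((1ℚ + (1ℚ + 0ℚ)) * (r * b) * v) * ((1ℚ + (1ℚ + 0ℚ)) * (r * b) * v)
    lemma′ = solve-∀ ℚ-ring
    square : ∀ j → zipf j * (b j * coll h i j) ≤ℚ (root-weight j * coll h i j) * (root-weight j * coll h i j)
    square j = subst (zipf j * (b j * coll h i j) ≤ℚ_)
      (trans (cong ((ι 2 * r) * (ι 2 * r) *_) (sym (idem (below*coll-Is01 B h i j)))) (lemma′ r (b j) (coll h i j)))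
      (*-mono-≤ʳ (b j * coll h i j) (*-nonneg (0≤below B (toℕ j)) (0≤coll h i j)) (inv≤√⁻¹² (toℕ j)))
      where
      r : ℚ
      r = √⁻¹ (toℕ j)

  -- The table to use is the one with the smaller root mass S, since then S² ≤ S S′. Either may be
  -- chosen, so both tails appear.
  excess-⊓ : ∀ h h′ →
    excess h i ⊓ excess h′ i ≤ℚ rootMass h * rootMass h′ + (tailMass h + tailMass h′)
  excess-⊓ h h′ with ℚP.≤-total (rootMass h) (rootMass h′)
  ... | inj₁ S≤S′ = ℚP.≤-trans (ℚP.p⊓q≤p (excess h i) (excess h′ i))
    (ℚP.≤-trans (excess≤rootMass²+tailMass h) (ℚP.+-mono-≤ (*-mono-≤ˡ (rootMass h) (0≤rootMass h) S≤S′)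
      (≤-by-gap (tailMass h′) (0≤tailMass h′) refl)))
  ... | inj₂ S′≤S = ℚP.≤-trans (ℚP.p⊓q≤q (excess h i) (excess h′ i))
    (ℚP.≤-trans (excess≤rootMass²+tailMass h′) (ℚP.+-mono-≤ (*-mono-≤ʳ (rootMass h′) (0≤rootMass h′) S′≤S)
      (≤-by-gap (tailMass h) (0≤tailMass h) (ℚP.+-comm (tailMass h) (tailMass h′)))))

  -- The weights `√⁻¹` telescope to at most `√ B`, so the mean is at most 2 `√ B` / B; and the
  -- square of `√ B` is at most 1 + 3B ≤ 4B.
  E-rootMass² : E (allHashes n B) rootMass * E (allHashes n B) rootMass ≤ℚ ι 16 * inv B
  E-rootMass² = begin
    E (allHashes n B) rootMass * E (allHashes n B) rootMass
      ≤⟨ *-mono-≤ 0≤E 0≤bound E≤bound E≤bound ⟩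
    (ι 2 * s * inv B) * (ι 2 * s * inv B)
      ≡⟨ lemma s (inv B) ⟩
    s * s * (ι 4 * (inv B * inv B))
      ≤⟨ *-mono-≤ʳ (ι 4 * (inv B * inv B)) (*-nonneg (0≤ι 4) (*-nonneg (0≤inv B) (0≤inv B))) s²≤4B ⟩
    ι 4 * ι B * (ι 4 * (inv B * inv B))
      ≡⟨ lemma′ (ι B) (inv B) ⟩
    ι 16 * (ι B * inv B * inv B)
      ≡⟨ cong (ι 16 *_) (trans (cong (_* inv B) (ι*inv B)) (ℚP.*-identityˡ (inv B))) ⟩
    ι 16 * inv B ∎
    where
    open ℚP.≤-Reasoning
    s : ℚ
    s = √ B
    0≤E : 0ℚ ≤ℚ E (allHashes n B) rootMass
    0≤E = subst (_≤ℚ E (allHashes n B) rootMass)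
      (E-const (allHashes n B) (allHashes-IsProb B n) 0ℚ) (E-mono (allHashes n B) 0≤rootMass)
    0≤bound : 0ℚ ≤ℚ ι 2 * s * inv B
    0≤bound = *-nonneg (*-nonneg (0≤ι 2) (0≤√ B)) (0≤inv B)
    E≤bound : E (allHashes n B) rootMass ≤ℚ ι 2 * s * inv B
    E≤bound = ℚP.≤-trans (E-linear root-weight 0≤root-weight)
      (*-mono-≤ʳ (inv B) (0≤inv B) (subst (_≤ℚ ι 2 * s) (sym (∑-*ˡ n (ι 2) (λ j → √⁻¹ (toℕ j) * b j)))
        (*-mono-≤ˡ (ι 2) (0≤ι 2) (ℚP.≤-trans (∑-telescope n B √ √⁻¹ 0≤√⁻¹ (λ j → refl))
          (≤-by-gap 1ℚ 0≤1 (gap s))))))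
      where
      gap : ∀ s → s ≡ s - 1ℚ + 1ℚ
      gap = solve-∀ ℚ-ring
    s²≤4B : s * s ≤ℚ ι 4 * ι B
    s²≤4B = ℚP.≤-trans (√²-upper B) (≤-by-gap (ι B - 1ℚ) (0≤b-a (ι-mono {1} (ℕ.>-nonZero⁻¹ B))) (gap (ι B)))
      where
      gap : ∀ x → (1ℚ + (1ℚ + (1ℚ + (1ℚ + 0ℚ)))) * x ≡ 1ℚ + (1ℚ + (1ℚ + (1ℚ + 0ℚ))) * x + (x - 1ℚ)
      gap = solve-∀ ℚ-ring
    lemma : ∀ s x → ((1ℚ + (1ℚ + 0ℚ)) * s * x) * ((1ℚ + (1ℚ + 0ℚ)) * s * x) ≡
                    s * s * ((1ℚ + (1ℚ + (1ℚ + (1ℚ + 0ℚ)))) * (x * x))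
    lemma = solve-∀ ℚ-ring
    assoc : ∀ f b x → f * b * (f * (x * x)) ≡ f * f * (b * x * x)
    assoc = solve-∀ ℚ-ring
    lemma′ : ∀ b x → ι 4 * b * (ι 4 * (x * x)) ≡ ι 16 * (b * x * x)
    lemma′ b x = trans (assoc (ι 4) b x) (cong (_* (b * x * x)) (sym (ι-* 4 4)))

  -- Each doubling of the range contributes 2: at most 2^(r+1) B items are charged 1/(2^r B) each.
  E-tailMass : ∀ d → n ≤ scale B d → E (allHashes n B) tailMass ≤ℚ ι d * ι 2 * inv B
  E-tailMass d n≤ = ℚP.≤-trans (E-linear tail-weight 0≤tail-weight) (*-mono-≤ʳ (inv B) (0≤inv B) (begin
    ∑ n tail-weight
      ≤⟨ ∑-mono n layer ⟩
    ∑ n (λ j → ∑ d (λ r → w r * below (scale B (suc (toℕ r))) (toℕ j)))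
      ≡⟨ ∑-swap n d (λ j r → w r * below (scale B (suc (toℕ r))) (toℕ j)) ⟩
    ∑ d (λ r → ∑ n (λ j → w r * below (scale B (suc (toℕ r))) (toℕ j)))
      ≡⟨ ∑-cong d (λ r → ∑-*ˡ n (w r) (λ j → below (scale B (suc (toℕ r))) (toℕ j))) ⟩
    ∑ d (λ r → w r * ∑ n (λ j → below (scale B (suc (toℕ r))) (toℕ j)))
      ≤⟨ ∑-mono d (λ r → *-mono-≤ˡ (w r) (0≤scale⁻¹ B (toℕ r)) (∑-below n (scale B (suc (toℕ r))))) ⟩
    ∑ d (λ r → w r * ι (scale B (suc (toℕ r))))
      ≡⟨ ∑-cong d (λ r → w*scale (toℕ r)) ⟩
    ∑ d (λ r → ι 2)
      ≡⟨ ∑-const d (ι 2) ⟩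
    ι d * ι 2 ∎))
    where
    open ℚP.≤-Reasoning
    w : Fin d → ℚ
    w r = scale⁻¹ B (toℕ r)
    w*scale : ∀ r → scale⁻¹ B r * ι (scale B (suc r)) ≡ ι 2
    w*scale r = trans (cong (scale⁻¹ B r *_) (trans (cong ι (ℕP.*-assoc 2 (2 ℕ.^ r) B)) (ι-* 2 (scale B r))))
      (trans (lemma (scale⁻¹ B r) (ι 2) (ι (scale B r)))
        (trans (cong (ι 2 *_) (scale*scale⁻¹ B r)) (ℚP.*-identityʳ (ι 2))))
      where
      lemma : ∀ a b c → a * (b * c) ≡ b * (c * a)
      lemma = solve-∀ ℚ-ring
    layer : ∀ j → tail-weight j ≤ℚ ∑ d (λ r → w r * below (scale B (suc (toℕ r))) (toℕ j))
    -- `scale B 0` is B, so the leading term of `layers` is the head `zipf j * b j`; moving it to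
    -- the left leaves `tail-weight j`.
    layer j = subst (_≤ℚ rest) (lemma (zipf j) (b j)) (-≤-by-+ {zipf j} {rest} {zipf j * b j}
      (subst (zipf j ≤ℚ_) (trans (cong (λ L → zipf j * below L (toℕ j) + rest) (ℕP.*-identityˡ B)) (ℚP.+-comm (zipf j * b j) rest))
        (layers d (scale⁻¹ B) (scale B) (toℕ j) (zipf j) (0≤inv (suc (toℕ j))) (0≤scale⁻¹ B)
          (λ r L≤j → inv≤scale⁻¹ B r (suc (toℕ j)) (ℕP.m≤n⇒m≤1+n L≤j))
          (ℕP.<-≤-trans (toℕ<n j) n≤))))
      where
      rest : ℚ
      rest = ∑ d (λ r → w r * below (scale B (suc (toℕ r))) (toℕ j))
      lemma : ∀ z b → z - z * b ≡ z * (1ℚ - b)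
      lemma = solve-∀ ℚ-ring

  expectedError-upper-log : ∀ k d → n ≤ scale B d →
    expectedError (suc (suc k)) n B i ≤ℚ (ι 16 + ι 4 * ι d) * inv B
  expectedError-upper-log k d n≤ = ℚP.≤-trans (expectedError-upper k n B i rootMass tailMass excess-⊓)
    (ℚP.≤-trans (ℚP.+-mono-≤ E-rootMass² (ℚP.+-mono-≤ (E-tailMass d n≤) (E-tailMass d n≤)))
      (ℚP.≤-reflexive (lemma (ι 16) (ι d) (inv B))))
    where
    lemma : ∀ a d x → a * x + (d * (1ℚ + (1ℚ + 0ℚ)) * x + d * (1ℚ + (1ℚ + 0ℚ)) * x) ≡
                      (a + (1ℚ + (1ℚ + (1ℚ + (1ℚ + 0ℚ)))) * d) * x
    lemma = solve-∀ ℚ-ring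

-- Lower bound for bounded n / B

-- For indicators the product is [Y = 0], so this is [Y ≥ 1] ≤ Y. The factor `1ℚ *` keeps the shape
-- of `E-∏-coll` at θ = 1.
weierstrass : ∀ n (w : Fin n → ℚ) → (∀ j → Is01 (w j)) → 1ℚ - ∏ n (λ j → 1ℚ - 1ℚ * w j) ≤ℚ ∑ n w
weierstrass zero    w w01 = ℚP.≤-refl
weierstrass (suc n) w w01 with w zero | w01 zero
... | _ | inj₁ refl = subst₂ _≤ℚ_ (lemma (∏ n (λ j → 1ℚ - 1ℚ * w (suc j)))) (sym (ℚP.+-identityˡ _))
  (weierstrass n (w ∘ suc) (w01 ∘ suc))
  where
  lemma : ∀ p → 1ℚ - p ≡ 1ℚ - (1ℚ - 1ℚ * 0ℚ) * p
  lemma = solve-∀ ℚ-ring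
... | _ | inj₂ refl = ≤-by-gap (∑ n (w ∘ suc)) (∑-nonneg n (λ j → 0≤Is01 (w01 (suc j))))
  (lemma (∏ n (λ j → 1ℚ - 1ℚ * w (suc j))) (∑ n (w ∘ suc)))
  where
  lemma : ∀ p y → 1ℚ + y ≡ 1ℚ - (1ℚ - 1ℚ * 1ℚ) * p + y
  lemma = solve-∀ ℚ-ring

∏-other-const : ∀ {n} (i : Fin (suc n)) x →
  ∏ (suc n) (λ j → 1ℚ - 1ℚ * (other i j * x)) ≡ pow (1ℚ - x) n
∏-other-const {n} zero x = trans (cong ((1ℚ - 1ℚ * (0ℚ * x)) *_) (∏-const n))
  (lemma x (pow (1ℚ - x) n))
  where
  lemma : ∀ x p → (1ℚ - 1ℚ * (0ℚ * x)) * p ≡ p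
  lemma = solve-∀ ℚ-ring
  lemma′ : ∀ x → 1ℚ - 1ℚ * (1ℚ * x) ≡ 1ℚ - x
  lemma′ = solve-∀ ℚ-ring
  ∏-const : ∀ n → ∏ n (λ j → 1ℚ - 1ℚ * (1ℚ * x)) ≡ pow (1ℚ - x) n
  ∏-const zero    = refl
  ∏-const (suc n) = cong₂ _*_ (lemma′ x) (∏-const n)
∏-other-const {suc n} (suc i) x = cong₂ _*_ (lemma x) (∏-other-const i x)
  where
  lemma : ∀ x → 1ℚ - 1ℚ * (1ℚ * x) ≡ 1ℚ - x
  lemma = solve-∀ ℚ-ring

-- For b > 0, 1 - 1/(b + 1) is the reciprocal of 1 + 1/b, so this is Bernoulli's inequality (1 +
-- 1/b)^m ≥ 1 + m/b cleared of denominators.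
pow-miss : ∀ b m → pow (1ℚ - inv (suc b)) m * ι (b ℕ.+ m) ≤ℚ ι b
pow-miss b zero = ℚP.≤-reflexive (trans (ℚP.*-identityˡ _) (cong ι (ℕP.+-identityʳ b)))
pow-miss b (suc m) = ℚP.≤-trans (subst₂ _≤ℚ_ eq (lemma₂ p (ι b) (ι m))
  (*-mono-≤ʳ p 0≤p (ℚP.+-monoʳ-≤ (ι b) (subst (q * ι m ≤ℚ_) (ℚP.*-identityˡ (ι m)) (*-mono-≤ʳ (ι m) (0≤ι m) q≤1)))))
  (subst (λ z → p * z ≤ℚ ι b) (ι-+ b m) (pow-miss b m))
  where
  x q p : ℚ
  x = inv (suc b)
  q = 1ℚ - x
  p = pow q m
  q≤1 : q ≤ℚ 1ℚ
  q≤1 = ≤-by-gap x (0≤inv (suc b)) (lemma x)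
    where
    lemma : ∀ x → 1ℚ ≡ 1ℚ - x + x
    lemma = solve-∀ ℚ-ring
  0≤p : 0ℚ ≤ℚ p
  0≤p = pow-nonneg m (0≤b-a (inv-anti 1 (suc b) (s≤s z≤n)))
  lemma₂ : ∀ p b m → (b + m) * p ≡ p * (b + m)
  lemma₂ = solve-∀ ℚ-ring
  lemma₃ : ∀ b x → b ≡ (1ℚ + b) * 1ℚ - 1ℚ
  lemma₃ = solve-∀ ℚ-ring
  lemma₄ : ∀ b x m p → ((1ℚ + b) * 1ℚ - (1ℚ + b) * x + (1ℚ - x) * m) * p ≡ (1ℚ - x) * p * (b + (1ℚ + m))
  lemma₄ = solve-∀ ℚ-ring
  eq : (ι b + q * ι m) * p ≡ q * p * ι (b ℕ.+ suc m)
  eq = begin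
    (ι b + q * ι m) * p
      ≡⟨ cong (λ z → (z + q * ι m) * p) (lemma₃ (ι b) x) ⟩
    (ι (suc b) * 1ℚ - 1ℚ + q * ι m) * p
      ≡⟨ cong (λ z → (ι (suc b) * 1ℚ - z + q * ι m) * p) (ι*inv (suc b)) ⟨
    (ι (suc b) * 1ℚ - ι (suc b) * x + q * ι m) * p
      ≡⟨ lemma₄ (ι b) x (ι m) p ⟩
    q * p * (ι b + ι (suc m))
      ≡⟨ cong (q * p *_) (ι-+ b (suc m)) ⟨
    q * p * ι (b ℕ.+ suc m) ∎
    where open ≡-Reasoning

-- k (1 - 1/B)^(n-1) ≤ k / (k + 1): even for n / B = 2 the union bound over the k tables is not void.
miss-probability : ∀ B .{{_ : NonZero B}} k m → 2 ≤ k → B ℕ.* k ≤ suc m →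
  ι (suc k) * pow (1ℚ - inv B) m ≤ℚ 1ℚ
-- A single bucket is treated apart because the general case divides by B - 1.
miss-probability 1 k zero 2≤k k≤n = contradiction
  (ℕP.≤-trans 2≤k (subst (_≤ 1) (ℕP.*-identityˡ k) k≤n)) λ { (s≤s ()) }
miss-probability 1 k (suc m) 2≤k k≤n = subst (_≤ℚ 1ℚ)
  (sym (trans (cong (ι (suc k) *_) (ℚP.*-zeroˡ (pow 0ℚ m))) (ℚP.*-zeroʳ (ι (suc k))))) 0≤1
miss-probability (suc (suc b)) k m 2≤k Bk≤n = subst₂ _≤ℚ_ eq (trans (ℚP.*-comm (inv (suc b)) (ι (suc b))) (ι*inv (suc b)))
  (*-mono-≤ˡ (inv (suc b)) (0≤inv (suc b)) (ℚP.≤-trans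
    (*-mono-≤ˡ p 0≤p (ι-mono kb≤)) (pow-miss (suc b) m)))
  where
  open ≡-Reasoning
  p : ℚ
  p = pow (1ℚ - inv (suc (suc b))) m
  0≤p : 0ℚ ≤ℚ p
  0≤p = pow-nonneg m (0≤b-a (inv-anti 1 (suc (suc b)) (s≤s z≤n)))
  kb≤ : suc b ℕ.* suc k ≤ suc b ℕ.+ m
  kb≤ = subst (_≤ suc b ℕ.+ m) (sym (ℕP.*-suc (suc b) k)) (ℕP.+-monoʳ-≤ (suc b)
    (ℕ.s≤s⁻¹ (ℕP.≤-trans (ℕP.+-monoˡ-≤ (suc b ℕ.* k) (ℕP.≤-trans (s≤s z≤n) 2≤k)) Bk≤n)))
  lemma : ∀ y p b k → y * (p * (b * k)) ≡ b * y * (k * p)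
  lemma = solve-∀ ℚ-ring
  eq : inv (suc b) * (p * ι (suc b ℕ.* suc k)) ≡ ι (suc k) * p
  eq = begin
    inv (suc b) * (p * ι (suc b ℕ.* suc k))
      ≡⟨ cong (λ z → inv (suc b) * (p * z)) (ι-* (suc b) (suc k)) ⟩
    inv (suc b) * (p * (ι (suc b) * ι (suc k)))
      ≡⟨ lemma (inv (suc b)) p (ι (suc b)) (ι (suc k)) ⟩
    ι (suc b) * inv (suc b) * (ι (suc k) * p)
      ≡⟨ cong (_* (ι (suc k) * p)) (ι*inv (suc b)) ⟩
    1ℚ * (ι (suc k) * p)
      ≡⟨ ℚP.*-identityˡ _ ⟩
    ι (suc k) * p ∎

-- The union bound leaves (1/n)(1 - k/(k + 1)). When n / B is bounded, so is k, and this has order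
-- 1/B.
expectedError-lower-crude : ∀ n B .{{_ : NonZero B}} k → 2 ≤ k → B ℕ.* k ≤ suc n → (i : Fin (suc n)) →
  inv (suc n) * inv (suc k) ≤ℚ expectedError k (suc n) B i
expectedError-lower-crude n B k 2≤k Bk≤n i = ℚP.≤-trans
  (subst₂ _≤ℚ_ refl eq (*-mono-≤ˡ z (0≤inv (suc n))
    inv≤1-kp))
  (expectedError-lower k (suc n) B (ℕP.≤-trans (s≤s z≤n) 2≤k) i z Ψ
    (λ h → *-nonneg (0≤inv (suc n)) (∏-nonneg (suc n) (λ j → 0≤1-1* (coll-Is01 h i j)))) z-Ψ≤)
  where
  z p : ℚ
  z = inv (suc n)
  p = pow (1ℚ - inv B) n
  miss Ψ : (Fin (suc n) → Fin B) → ℚ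
  miss h = ∏ (suc n) (λ j → 1ℚ - 1ℚ * coll h i j)
  Ψ h = z * miss h
  0≤1-1* : ∀ {w} → Is01 w → 0ℚ ≤ℚ 1ℚ - 1ℚ * w
  0≤1-1* (inj₁ refl) = 0≤1
  0≤1-1* (inj₂ refl) = ℚP.≤-refl
  z-Ψ≤ : ∀ h → z - Ψ h ≤ℚ excess h i
  z-Ψ≤ h = ℚP.≤-trans (subst (_≤ℚ z * ∑ (suc n) (coll h i)) (lemma z (miss h))
    (*-mono-≤ˡ z (0≤inv (suc n)) (weierstrass (suc n) (coll h i) (coll-Is01 h i))))
    (subst (_≤ℚ excess h i) (∑-*ˡ (suc n) z (coll h i)) (∑-mono (suc n) (λ j →
      *-mono-≤ʳ (coll h i j) (0≤coll h i j) (inv-anti (suc (toℕ j)) (suc n) (toℕ<n j)))))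
    where
    lemma : ∀ z m → z * (1ℚ - m) ≡ z - z * m
    lemma = solve-∀ ℚ-ring
  eq : z * (1ℚ - ι k * p) ≡ z - ι k * E (allHashes (suc n) B) Ψ
  eq = trans (lemma z (ι k) p) (cong (λ e → z - ι k * e) (sym (trans
    (E-*ˡ (allHashes (suc n) B) z miss)
    (cong (z *_) (trans (E-∏-coll B i (λ _ → 1ℚ)) (∏-other-const i (inv B)))))))
    where
    lemma : ∀ z k p → z * (1ℚ - k * p) ≡ z - k * (z * p)
    lemma = solve-∀ ℚ-ring
  p≤inv : p ≤ℚ inv (suc k)
  p≤inv = subst (p ≤ℚ_) (ℚP.*-identityʳ (inv (suc k))) (≤-by-cross (suc k) (miss-probability B k n 2≤k Bk≤n))
  inv≤1-kp : inv (suc k) ≤ℚ 1ℚ - ι k * p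
  inv≤1-kp = subst (_≤ℚ 1ℚ - ι k * p)
    (trans (cong (λ o → o - ι k * inv (suc k)) (sym (ι*inv (suc k)))) (lemma (ι k) (inv (suc k))))
    (ℚP.+-monoʳ-≤ 1ℚ (ℚP.neg-antimono-≤ (*-mono-≤ˡ (ι k) (0≤ι k) p≤inv)))
    where
    lemma : ∀ k x → (1ℚ + k) * x - k * x ≡ x
    lemma = solve-∀ ℚ-ring

-- Binary logarithms and the choice of the constants

2^⌊log₂⌋-lower : ∀ m n → 1 ≤ n → m ≤ ⌊log₂ n ⌋ → 2 ℕ.^ m ≤ n
2^⌊log₂⌋-lower zero    n 1≤n m≤log = 1≤n
2^⌊log₂⌋-lower (suc m) (suc zero) 1≤n ()
2^⌊log₂⌋-lower (suc m) (suc (suc n)) 1≤n m≤log = ℕP.≤-trans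
  (ℕP.*-monoʳ-≤ 2 (2^⌊log₂⌋-lower m half (s≤s z≤n) (subst (m ≤_) (sym (⌊log₂⌊n/2⌋⌋≡⌊log₂n⌋∸1 (suc (suc n)))) (ℕP.∸-monoˡ-≤ 1 m≤log))))
  (ℕP.≤-trans (ℕP.+-monoʳ-≤ half (subst (_≤ ℕ.⌈ suc (suc n) /2⌉) (sym (ℕP.+-identityʳ half)) (ℕP.⌊n/2⌋≤⌈n/2⌉ (suc (suc n)))))
    (ℕP.≤-reflexive (ℕP.⌊n/2⌋+⌈n/2⌉≡n (suc (suc n)))))
  where
  half : ℕ
  half = ℕ.⌊ suc (suc n) /2⌋

2^⌊log₂⌋-upper : ∀ n → n ℕ.< 2 ℕ.^ suc ⌊log₂ n ⌋
2^⌊log₂⌋-upper n with ℕP.<-≤-connex n (2 ℕ.^ suc ⌊log₂ n ⌋)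
... | inj₁ n< = n<
... | inj₂ ≤n = contradiction
  (subst (_≤ ⌊log₂ n ⌋) (⌊log₂[2^n]⌋≡n (suc ⌊log₂ n ⌋)) (⌊log₂⌋-mono-≤ ≤n)) ℕP.1+n≰n

-- Used for 2k ≤ 2^(M+2) ≤ 2^(2t+7) ≤ 2^(2^t) when M ≤ 2t + 5. The least t with 2t + 7 ≤ 2^t is 4,
-- and with 2t + 4 ≤ M this sets the threshold M ≥ 12.
2t+7≤2^t : ∀ e → 2 ℕ.* (4 ℕ.+ e) ℕ.+ 7 ≤ 2 ℕ.^ (4 ℕ.+ e)
2t+7≤2^t zero    = ℕP.n≤1+n 15
2t+7≤2^t (suc e) = ℕP.≤-trans
  (subst (2 ℕ.* (5 ℕ.+ e) ℕ.+ 7 ≤_) (lemma e) (ℕP.m≤m+n (2 ℕ.* (5 ℕ.+ e) ℕ.+ 7) (2 ℕ.* e ℕ.+ 13)))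
  (ℕP.*-monoʳ-≤ 2 (2t+7≤2^t e))
  where
  lemma : ∀ e → 2 ℕ.* (5 ℕ.+ e) ℕ.+ 7 ℕ.+ (2 ℕ.* e ℕ.+ 13) ≡ 2 ℕ.* (2 ℕ.* (4 ℕ.+ e) ℕ.+ 7)
  lemma = ℕ-solve-∀

module _ (n B k : ℕ) .{{_ : NonZero B}} (2≤k : 2 ≤ k) (Bk≤n : B ℕ.* k ≤ n) (i : Fin n) where

  private
    N M : ℕ
    N = n / B
    M = ⌊log₂ N ⌋

    k≤N : k ≤ N
    k≤N = subst (_≤ N) (m*n/n≡m k B) (/-monoˡ-≤ B (subst (_≤ n) (ℕP.*-comm B k) Bk≤n))

    1≤N : 1 ≤ N
    1≤N = ℕP.≤-trans (ℕP.≤-trans (s≤s z≤n) 2≤k) k≤N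

    1≤M : 1 ≤ M
    1≤M = ⌊log₂⌋-mono-≤ (ℕP.≤-trans 2≤k k≤N)

    k<2^[1+M] : k ℕ.< 2 ℕ.^ suc M
    k<2^[1+M] = ℕP.≤-<-trans k≤N (2^⌊log₂⌋-upper N)

    scale-M≤n : scale B M ≤ n
    scale-M≤n = ℕP.≤-trans (ℕP.*-monoˡ-≤ B (2^⌊log₂⌋-lower M N 1≤N ℕP.≤-refl)) (m/n*n≤m n B)

    n≤scale-[1+M] : n ≤ scale B (suc M)
    n≤scale-[1+M] = ℕP.≤-trans
      (subst (_≤ suc N ℕ.* B) (sym (m≡m%n+[m/n]*n n B)) (ℕP.+-monoˡ-≤ (N ℕ.* B) (m%n≤n n B)))
      (ℕP.*-monoˡ-≤ B (2^⌊log₂⌋-upper N))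

  expectedError≤ : expectedError k n B i ≤ℚ ι 24 * ((+ M) ℚ./ B)
  expectedError≤ = ℚP.≤-trans (upper-log k 2≤k)
    (subst₂ _≤ℚ_ refl (sym (trans (cong (ι 24 *_) (/-as-product M B)) (sym (ℚP.*-assoc (ι 24) (ι M) (inv B)))))
      (*-mono-≤ʳ (inv B) (0≤inv B) (subst₂ _≤ℚ_ eq₁ (ι-* 24 M) (ι-mono 16+4[1+M]≤24M))))
    where
    upper-log : ∀ k → 2 ≤ k → expectedError k n B i ≤ℚ (ι 16 + ι 4 * ι (suc M)) * inv B
    upper-log (suc (suc k)) _ = expectedError-upper-log B i k (suc M) n≤scale-[1+M]
    upper-log (suc zero) (s≤s ())
    eq₁ : ι (16 ℕ.+ 4 ℕ.* suc M) ≡ ι 16 + ι 4 * ι (suc M)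
    eq₁ = trans (ι-+ 16 (4 ℕ.* suc M)) (cong (λ z → ι 16 + z) (ι-* 4 (suc M)))
    -- Here M ≥ 1 turns 20 + 4M into 24M, absorbing the contribution of the first B items and the
    -- rounding of the logarithm.
    16+4[1+M]≤24M : 16 ℕ.+ 4 ℕ.* suc M ≤ 24 ℕ.* M
    16+4[1+M]≤24M = subst₂ _≤_ (lemma M) (lemma′ M) (ℕP.+-monoˡ-≤ (4 ℕ.* M) (ℕP.*-monoʳ-≤ 20 1≤M))
      where
      lemma : ∀ M → 20 ℕ.+ 4 ℕ.* M ≡ 16 ℕ.+ 4 ℕ.* suc M
      lemma = ℕ-solve-∀
      lemma′ : ∀ M → 20 ℕ.* M ℕ.+ 4 ℕ.* M ≡ 24 ℕ.* M
      lemma′ = ℕ-solve-∀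

  -- The 2 + t scales start at t, about M/2: large enough that 2^t exceeds log₂(2k), small enough
  -- that all scales fit below n. As M ≤ 4(2 + t), they yield (2 + t)/(8B) ≥ M/(32B). The parameter
  -- `e` only weakens the constant to one shared with `lower-small`.
  lower-large : ∀ e t → 4 ≤ t → 2 ℕ.* t ℕ.+ 4 ≤ M → M ≤ 2 ℕ.* t ℕ.+ 5 →
    pow ½ (5 ℕ.+ e) * (ι M * inv B) ≤ℚ expectedError k n B i
  lower-large e t 4≤t 2t+4≤M M≤2t+5 = ℚP.≤-trans
    (subst₂ _≤ℚ_ (lemma (pow ½ e) (ι M) (inv B))
      (trans (cong (λ z → 1ℚ * z * (½ * ½ * ½ * ½ * ½ * inv B)) (ι-* 4 (2 ℕ.+ t))) (lemma′ (ι (2 ℕ.+ t)) (inv B)))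
      (*-mono-≤ʳ (½ * ½ * ½ * ½ * ½ * inv B) 0≤½⁵x
        (*-mono-≤ (pow-nonneg e 0≤½) (0≤ι (4 ℕ.* (2 ℕ.+ t))) (pow-½≤1 e) (ι-mono M≤4d))))
    (expectedError-lower-log B i t (2 ℕ.+ t) k (ℕP.≤-trans (s≤s z≤n) 2≤k)
      (λ r → ℕP.≤-trans (ℕP.*-monoˡ-≤ B (ℕP.^-monoʳ-≤ 2 (block≤M r))) scale-M≤n)
      (ℕP.≤-trans (ℕP.*-monoʳ-≤ 2 (ℕP.<⇒≤ k<2^[1+M])) (ℕP.^-monoʳ-≤ 2 (ℕP.≤-trans (s≤s (s≤s M≤2t+5)) 2t+7≤))))
    where
    0≤½⁵x : 0ℚ ≤ℚ ½ * ½ * ½ * ½ * ½ * inv B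
    0≤½⁵x = *-nonneg (ℚP.nonNegative⁻¹ (½ * ½ * ½ * ½ * ½)) (0≤inv B)
    pow-½≤1 : ∀ e → pow ½ e ≤ℚ 1ℚ
    pow-½≤1 zero    = ℚP.≤-refl
    pow-½≤1 (suc e) = *-mono-≤ {b = 1ℚ} {d = 1ℚ} 0≤½ 0≤1 (≤-by-gap ½ 0≤½ refl) (pow-½≤1 e)
    lemma : ∀ p m x → p * m * (½ * ½ * ½ * ½ * ½ * x) ≡ (½ * (½ * (½ * (½ * (½ * p))))) * (m * x)
    lemma = solve-∀ ℚ-ring
    lemma′ : ∀ d x → 1ℚ * ((1ℚ + (1ℚ + (1ℚ + (1ℚ + 0ℚ)))) * d) * (½ * ½ * ½ * ½ * ½ * x) ≡ d * (½ * ½ * ½ * x)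
    lemma′ = solve-∀ ℚ-ring
    M≤4d : M ≤ 4 ℕ.* (2 ℕ.+ t)
    M≤4d = ℕP.≤-trans M≤2t+5 (subst (2 ℕ.* t ℕ.+ 5 ≤_) (eq t) (ℕP.m≤m+n (2 ℕ.* t ℕ.+ 5) (2 ℕ.* t ℕ.+ 3)))
      where
      eq : ∀ t → 2 ℕ.* t ℕ.+ 5 ℕ.+ (2 ℕ.* t ℕ.+ 3) ≡ 4 ℕ.* (2 ℕ.+ t)
      eq = ℕ-solve-∀
    block≤M : ∀ (r : Fin (2 ℕ.+ t)) → 2 ℕ.+ (toℕ r ℕ.+ t) ≤ M
    block≤M r = ℕP.≤-trans (ℕP.+-monoʳ-≤ 2 (ℕP.+-monoˡ-≤ t (ℕP.<⇒≤ (toℕ<n r))))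
      (subst (_≤ M) (eq t) 2t+4≤M)
      where
      eq : ∀ t → 2 ℕ.* t ℕ.+ 4 ≡ 2 ℕ.+ (2 ℕ.+ t ℕ.+ t)
      eq = ℕ-solve-∀
    2t+7≤ : 2 ℕ.+ (2 ℕ.* t ℕ.+ 5) ≤ 2 ℕ.^ t
    2t+7≤ = subst (λ t → 2 ℕ.+ (2 ℕ.* t ℕ.+ 5) ≤ 2 ℕ.^ t) (ℕP.m+[n∸m]≡n 4≤t)
      (subst (_≤ 2 ℕ.^ (4 ℕ.+ (t ℕ.∸ 4))) (eq (4 ℕ.+ (t ℕ.∸ 4))) (2t+7≤2^t (t ℕ.∸ 4)))
      where
      eq : ∀ t → 2 ℕ.* t ℕ.+ 7 ≡ 2 ℕ.+ (2 ℕ.* t ℕ.+ 5)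
      eq = ℕ-solve-∀

  -- From n ≤ 2^(M+1) B, k + 1 ≤ 2^(M+1) and M ≤ 2^M follows n (k + 1) M ≤ 2^(3M+2) B, so the crude
  -- bound suffices.
  lower-small : ∀ e → 3 ℕ.* M ℕ.+ 2 ≤ e → pow ½ e * (ι M * inv B) ≤ℚ expectedError k n B i
  lower-small e 3M+2≤e = ℚP.≤-trans
    (bound n {{nonZeroIndex i}} (ℕP.≤-trans (ℕP.*-mono-≤ (ℕP.*-mono-≤ n≤scale-[1+M] k<2^[1+M]) (ℕP.<⇒≤ (1+n≤2^n M)))
      (ℕP.≤-trans (ℕP.≤-reflexive (eq M)) (ℕP.*-monoˡ-≤ B (ℕP.^-monoʳ-≤ 2 3M+2≤e)))))
    (crude n {{nonZeroIndex i}} Bk≤n i)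
    where
    nonZeroIndex : ∀ {n} → Fin n → NonZero n
    nonZeroIndex {suc n} _ = _
    crude : ∀ n .{{_ : NonZero n}} → B ℕ.* k ≤ n → (i : Fin n) → inv n * inv (suc k) ≤ℚ expectedError k n B i
    crude (suc n) Bk≤n i = expectedError-lower-crude n B k 2≤k Bk≤n i
    eq : ∀ M → (2 ℕ.^ suc M ℕ.* B) ℕ.* 2 ℕ.^ suc M ℕ.* 2 ℕ.^ M ≡ 2 ℕ.^ (3 ℕ.* M ℕ.+ 2) ℕ.* B
    eq M = trans (lemma (2 ℕ.^ M) B) (cong (ℕ._* B) (sym (trans (ℕP.^-distribˡ-+-* 2 (3 ℕ.* M) 2)
      (cong (ℕ._* 4) (trans (cong (2 ℕ.^_) (ℕP.*-comm 3 M)) (sym (ℕP.^-*-assoc 2 M 3)))))))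
      where
      lemma : ∀ a B → (2 ℕ.* a ℕ.* B) ℕ.* (2 ℕ.* a) ℕ.* a ≡ a ℕ.* (a ℕ.* (a ℕ.* 1)) ℕ.* 4 ℕ.* B
      lemma = ℕ-solve-∀
    bound : ∀ n .{{_ : NonZero n}} → n ℕ.* suc k ℕ.* M ≤ 2 ℕ.^ e ℕ.* B →
      pow ½ e * (ι M * inv B) ≤ℚ inv n * inv (suc k)
    bound n nkM≤ = ≤-by-cross n (subst (ι n * (pow ½ e * (ι M * inv B)) ≤ℚ_) (ℚP.*-identityʳ (inv (suc k)))
      (≤-by-cross (suc k) (subst₂ _≤ℚ_
        (trans (cong (_* (pow ½ e * inv B)) (trans (ι-* (n ℕ.* suc k) M) (cong (_* ι M) (ι-* n (suc k)))))
          (lemma (ι n) (ι (suc k)) (ι M) (pow ½ e) (inv B)))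
        (trans (cong (_* (pow ½ e * inv B)) (ι-* (2 ℕ.^ e) B))
          (trans (lemma′ (ι (2 ℕ.^ e)) (ι B) (pow ½ e) (inv B)) (cong₂ _*_ (pow-½ e) (ι*inv B))))
        (*-mono-≤ʳ (pow ½ e * inv B) (*-nonneg (pow-nonneg e 0≤½) (0≤inv B)) (ι-mono nkM≤)))))
      where
      lemma : ∀ n k m p x → n * k * m * (p * x) ≡ k * (n * (p * (m * x)))
      lemma = solve-∀ ℚ-ring
      lemma′ : ∀ a b p x → a * b * (p * x) ≡ (a * p) * (b * x)
      lemma′ = solve-∀ ℚ-ring

  ≤expectedError : ∀ e → 30 ≤ e → pow ½ (5 ℕ.+ e) * ((+ M) ℚ./ B) ≤ℚ expectedError k n B i
  ≤expectedError e 30≤e = subst (λ z → pow ½ (5 ℕ.+ e) * z ≤ℚ expectedError k n B i) (sym (/-as-product M B)) bound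
    where
    bound : pow ½ (5 ℕ.+ e) * (ι M * inv B) ≤ℚ expectedError k n B i
    bound with ℕP.<-≤-connex M 12
    -- For M ≤ 11 the exponent 3M + 2 is at most 35 = 5 + 30, which fixes the final constant
    -- 2^(-35).
    ... | inj₁ (s≤s M≤11) = lower-small (5 ℕ.+ e)
      (ℕP.≤-trans (ℕP.+-monoˡ-≤ 2 (ℕP.*-monoʳ-≤ 3 M≤11)) (ℕP.+-monoʳ-≤ 5 30≤e))
    -- This t is ⌊M/2⌋ - 2, so M is 2t + 4 or 2t + 5.
    ... | inj₂ 12≤M = lower-large e (4 ℕ.+ half) (ℕP.m≤m+n 4 half)
      (subst₂ _≤_ (lemma half) (ℕP.m+[n∸m]≡n 12≤M)
        (ℕP.+-monoʳ-≤ 12 (subst (half ℕ.+ half ≤_) halves (ℕP.+-monoʳ-≤ half (ℕP.⌊n/2⌋≤⌈n/2⌉ rest)))))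
      (subst₂ _≤_ (ℕP.m+[n∸m]≡n 12≤M) (lemma′ half)
        (ℕP.+-monoʳ-≤ 12 (subst (_≤ half ℕ.+ suc half) halves (ℕP.+-monoʳ-≤ half (⌈n/2⌉≤1+⌊n/2⌋ rest)))))
      where
      rest half : ℕ
      rest = M ℕ.∸ 12
      half = ℕ.⌊ rest /2⌋
      halves : half ℕ.+ ℕ.⌈ rest /2⌉ ≡ rest
      halves = ℕP.⌊n/2⌋+⌈n/2⌉≡n rest
      ⌈n/2⌉≤1+⌊n/2⌋ : ∀ n → ℕ.⌈ n /2⌉ ≤ suc ℕ.⌊ n /2⌋
      ⌈n/2⌉≤1+⌊n/2⌋ n = ℕP.⌊n/2⌋-mono (ℕP.n≤1+n (suc n))
      lemma : ∀ a → 12 ℕ.+ (a ℕ.+ a) ≡ 2 ℕ.* (4 ℕ.+ a) ℕ.+ 4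
      lemma = ℕ-solve-∀
      lemma′ : ∀ a → 12 ℕ.+ (a ℕ.+ suc a) ≡ 2 ℕ.* (4 ℕ.+ a) ℕ.+ 5
      lemma′ = ℕ-solve-∀

0<pow-½ : ∀ e → 0ℚ < pow ½ e
0<pow-½ zero    = ℚP.positive⁻¹ 1ℚ
0<pow-½ (suc e) = subst (_< ½ * pow ½ e) (ℚP.*-zeroʳ ½) (ℚP.*-monoʳ-<-pos ½ (0<pow-½ e))

-- As n / B ≥ k ≥ 2, the rounded logarithm is at least 1 and within a factor 2 of log₂(n / B), so
-- the rounding affects only the constants.
theorem3p1 : Σ ℚ λ c → Σ ℚ λ C → (0ℚ < c) × (0ℚ < C) ×
    ((n B k : ℕ) → .{{_ : NonZero B}} → 2 ≤ k → B ℕ.* k ≤ n → (i : Fin n) →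
    (c * ((+ ⌊log₂ (n / B) ⌋) ℚ./ B) ℚ.≤ expectedError k n B i)
    × (expectedError k n B i ℚ.≤ C * ((+ ⌊log₂ (n / B) ⌋) ℚ./ B)))
theorem3p1 = pow ½ 35 , ι 24 , 0<pow-½ 35 , ℚP.positive⁻¹ (ι 24) ,
  λ n B k 2≤k Bk≤n i → ≤expectedError n B k 2≤k Bk≤n i 30 ℕP.≤-refl , expectedError≤ n B k 2≤k Bk≤n i
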